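{- Let $G_5=C_5\times C_5$ be the elementary abelian group of order $25$, and let $S(G_5)\subseteq\mathbb{Z}$ be the set of all values of its group determinant at integer arguments. Then \[ S(G_5)=\{m\in\mathbb{Z} : m\equiv\pm1\text{ or }\pm7\pmod{25}\}\cup 5^8\mathbb{Z}. \]
   Context: For a finite group $G$, the group determinant is $\Theta_G((x_g)_{g\in G})=\det(x_{gh^{ -1}})_{g,h\in G}$, and $S(G):=\{\Theta_G((a_g)_{g\in G}) : a_g\in\mathbb{Z}\}\subseteq\mathbb{Z}$. $C_n$ denotes the cyclic group of order $n$. For $n,k\ge 1$, $n^k\mathbb{Z}$ denotes the set of integer multiples of $n^k$. -}

module Defs where

open import Level using (0ℓ)
open import Algebra.Bundles using (Group)
import Algebra.Construct.DirectProduct as DirectProduct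
open import Data.Fin.Base using (Fin; zero; suc; toℕ; punchIn)
open import Data.Fin.Properties using (toℕ-fromℕ<; toℕ-injective; toℕ<n; toℕ≤n; *↔×)
open import Data.Integer.Base as ℤ using (ℤ; +_; -1ℤ; 1ℤ)
open import Data.Integer.Divisibility.Signed using (_∣_)
import Data.Integer.Properties as ℤ
open import Data.Nat.Base as ℕ using (ℕ; NonZero)
open import Data.Nat.DivMod using (_%_; _mod_; m%n<n; m<n⇒m%n≡m; n%n≡0; %-distribˡ-+)
import Data.Nat.Properties as ℕ
open import Data.Product.Base using (_,_; ∃)
open import Data.Product.Function.NonDependent.Setoid using (_×-inverse_)
open import Data.Product.Relation.Binary.Pointwise.NonDependent using (Pointwise-≡↔≡)
import Function.Construct.Composition as Composition
import Function.Construct.Identity as Identity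
import Function.Construct.Symmetry as Symmetry
open import Function.Bundles using (Func; Inverse)
open import Relation.Binary.PropositionalEquality
  using (_≡_; refl; sym; trans; cong; cong₂; isEquivalence; setoid; module ≡-Reasoning)
open import Relation.Unary using (Pred)
open import Algebra.Properties.CommutativeMonoid.Sum ℤ.+-0-commutativeMonoid using (sum)

Matrix : ℕ → Set
Matrix n = Fin n → Fin n → ℤ

-- Cofactor expansion along the first row; `punchIn j` enumerates the
-- columns other than j in increasing order.
det : ∀ {n} → Matrix n → ℤ
det {ℕ.zero}  A = 1ℤ
det {ℕ.suc n} A =
  sum λ j → -1ℤ ℤ.^ toℕ j ℤ.* A zero j ℤ.* det (λ i k → A (suc i) (punchIn j k))

-- The enumeration only serves to index matrices by Fin.  Rows and columns
-- use the same enumeration, so the group determinant does not depend on it.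
record FiniteGroup : Set₁ where
  field
    group       : Group 0ℓ 0ℓ
    order       : ℕ
    enumeration : Inverse (setoid (Fin order)) (Group.setoid group)

  open Group group public renaming (setoid to carrierSetoid)

  element : Fin order → Carrier
  element = Inverse.to enumeration

-- Integer families indexed by the elements of G; they are required to
-- respect the group's own equality.
Family : FiniteGroup → Set
Family G = Func (FiniteGroup.carrierSetoid G) (setoid ℤ)

Θ : (G : FiniteGroup) → Family G → ℤ
Θ G x = det λ i j → Func.to x (element i ∙ element j ⁻¹)
  where open FiniteGroup G

S : FiniteGroup → Pred ℤ 0ℓ
S G m = ∃ λ (a : Family G) → m ≡ Θ G a

module _ (n : ℕ) .{{_ : NonZero n}} where

  private
    infixl 6 _⊕_
    _⊕_ : Fin n → Fin n → Fin n
    i ⊕ j = (toℕ i ℕ.+ toℕ j) mod n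

    ⊖_ : Fin n → Fin n
    ⊖ i = (n ℕ.∸ toℕ i) mod n

    𝟘 : Fin n
    𝟘 = 0 mod n

    toℕ-mod : ∀ k → toℕ (k mod n) ≡ k % n
    toℕ-mod k = toℕ-fromℕ< (m%n<n k n)

    toℕ-% : ∀ (i : Fin n) → toℕ i % n ≡ toℕ i
    toℕ-% i = m<n⇒m%n≡m (toℕ<n i)

    mod-⊕ : ∀ k l → (k mod n) ⊕ (l mod n) ≡ (k ℕ.+ l) mod n
    mod-⊕ k l = toℕ-injective (begin
      toℕ ((k mod n) ⊕ (l mod n))             ≡⟨ toℕ-mod _ ⟩
      (toℕ (k mod n) ℕ.+ toℕ (l mod n)) % n   ≡⟨ cong (_% n) (cong₂ ℕ._+_ (toℕ-mod k) (toℕ-mod l)) ⟩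
      (k % n ℕ.+ l % n) % n                   ≡⟨ sym (%-distribˡ-+ k l n) ⟩
      (k ℕ.+ l) % n                           ≡⟨ sym (toℕ-mod _) ⟩
      toℕ ((k ℕ.+ l) mod n)                   ∎)
      where open ≡-Reasoning

    mod-toℕ : ∀ (i : Fin n) → toℕ i mod n ≡ i
    mod-toℕ i = toℕ-injective (trans (toℕ-mod _) (toℕ-% i))

    n-mod : n mod n ≡ 𝟘
    n-mod = toℕ-injective (begin
      toℕ (n mod n) ≡⟨ toℕ-mod n ⟩
      n % n         ≡⟨ n%n≡0 n ⟩
      0             ≡⟨ sym (m<n⇒m%n≡m (ℕ.>-nonZero⁻¹ n)) ⟩
      0 % n         ≡⟨ sym (toℕ-mod 0) ⟩
      toℕ 𝟘         ∎)
      where open ≡-Reasoning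

    ⊕-comm : ∀ i j → i ⊕ j ≡ j ⊕ i
    ⊕-comm i j = cong (_mod n) (ℕ.+-comm (toℕ i) (toℕ j))

    ⊕-assoc : ∀ i j k → (i ⊕ j) ⊕ k ≡ i ⊕ (j ⊕ k)
    ⊕-assoc i j k = begin
      (i ⊕ j) ⊕ k                            ≡⟨ cong ((i ⊕ j) ⊕_) (sym (mod-toℕ k)) ⟩
      (i ⊕ j) ⊕ (toℕ k mod n)                ≡⟨ mod-⊕ _ _ ⟩
      (toℕ i ℕ.+ toℕ j ℕ.+ toℕ k) mod n      ≡⟨ cong (_mod n) (ℕ.+-assoc (toℕ i) (toℕ j) (toℕ k)) ⟩
      (toℕ i ℕ.+ (toℕ j ℕ.+ toℕ k)) mod n    ≡⟨ sym (mod-⊕ _ _) ⟩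
      (toℕ i mod n) ⊕ (j ⊕ k)                ≡⟨ cong (_⊕ (j ⊕ k)) (mod-toℕ i) ⟩
      i ⊕ (j ⊕ k)                            ∎
      where open ≡-Reasoning

    ⊕-identityˡ : ∀ i → 𝟘 ⊕ i ≡ i
    ⊕-identityˡ i = begin
      𝟘 ⊕ i               ≡⟨ cong (𝟘 ⊕_) (sym (mod-toℕ i)) ⟩
      𝟘 ⊕ (toℕ i mod n)   ≡⟨ mod-⊕ 0 (toℕ i) ⟩
      toℕ i mod n         ≡⟨ mod-toℕ i ⟩
      i                   ∎
      where open ≡-Reasoning

    ⊕-inverseˡ : ∀ i → (⊖ i) ⊕ i ≡ 𝟘
    ⊕-inverseˡ i = begin
      (⊖ i) ⊕ i                        ≡⟨ cong ((⊖ i) ⊕_) (sym (mod-toℕ i)) ⟩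
      (⊖ i) ⊕ (toℕ i mod n)            ≡⟨ mod-⊕ (n ℕ.∸ toℕ i) (toℕ i) ⟩
      (n ℕ.∸ toℕ i ℕ.+ toℕ i) mod n    ≡⟨ cong (_mod n) (ℕ.m∸n+n≡m (toℕ≤n i)) ⟩
      n mod n                          ≡⟨ n-mod ⟩
      𝟘                                ∎
      where open ≡-Reasoning

  cyclicGroup : Group 0ℓ 0ℓ
  cyclicGroup = record
    { Carrier = Fin n
    ; _≈_     = _≡_
    ; _∙_     = _⊕_
    ; ε       = 𝟘
    ; _⁻¹     = ⊖_
    ; isGroup = record
      { isMonoid = record
        { isSemigroup = record
          { isMagma = record
            { isEquivalence = isEquivalence
            ; ∙-cong        = cong₂ _⊕_
            }
          ; assoc = ⊕-assoc
          }
        ; identity = ⊕-identityˡ , λ i → trans (⊕-comm i 𝟘) (⊕-identityˡ i)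
        }
      ; inverse = ⊕-inverseˡ , λ i → trans (⊕-comm i (⊖ i)) (⊕-inverseˡ i)
      ; ⁻¹-cong = cong ⊖_
      }
    }

  C : FiniteGroup
  C = record
    { group       = cyclicGroup
    ; order       = n
    ; enumeration = Identity.inverse (setoid (Fin n))
    }

infixr 2 _×ᴳ_
_×ᴳ_ : FiniteGroup → FiniteGroup → FiniteGroup
G ×ᴳ H = record
  { group       = DirectProduct.group G.group H.group
  ; order       = G.order ℕ.* H.order
  ; enumeration =
      Composition.inverse *↔×
        (Composition.inverse (Symmetry.inverse Pointwise-≡↔≡)
          (G.enumeration ×-inverse H.enumeration))
  }
  where
  module G = FiniteGroup G
  module H = FiniteGroup H

G₅ : FiniteGroup
G₅ = C 5 ×ᴳ C 5

infix 4 _≡_[mod_]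
_≡_[mod_] : ℤ → ℤ → ℕ → Set
a ≡ b [mod n ] = + n ∣ a ℤ.- b

multiplesOfPower : ℕ → ℕ → Pred ℤ 0ℓ
multiplesOfPower n k m = + (n ℕ.^ k) ∣ m

{-# OPTIONS --safe #-}
-- Over ℤ[ζ], with ζ a primitive fifth root of unity, the characters of C₅ × C₅
-- diagonalise the group matrix, so the group determinant Θ is the product of the
-- character values: the sum s of all coefficients times six norms from ℤ[ζ], one for
-- each Galois orbit of nontrivial characters, that is, for each line of 𝔽₅².
--
-- If 5 ∣ s, all six norms are divisible by 5.  The norm at the line of (u , v) is even
-- divisible by 25 when 5 divides uP + vQ, with P and Q the first moments of the
-- coefficients, and every (P , Q) is orthogonal to some line; so 5⁸ ∣ Θ.
--
-- If 5 ∤ s, multiply over the first coordinate of the characters first.  This gives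
-- elements of ℤ[C₅] that are circulants and hence, by the Frobenius map, congruent
-- modulo 5 to a constant.  A circulant with entries (c + 5r₀, 5r₁, …, 5r₄) is congruent
-- modulo 25 to the fifth power of their sum, which is s⁵ modulo 5; so Θ ≡ s²⁵ modulo 25.
--
-- Conversely, adding k to all coefficients changes only the value of the trivial
-- character, by 25k, so finitely many explicit elements realise all the claimed values.
module Submission where

open import Algebra.Bundles using (CommutativeMonoid; CommutativeRing; Group; RawRing)
open import Algebra.Consequences.Propositional using (comm∧distrˡ⇒distrʳ; comm∧idˡ⇒id; comm∧invˡ⇒inv)
open import Algebra.Core using (Op₁; Op₂)
import Algebra.Morphism.Construct.Identity as Identity
open import Algebra.Morphism.Structures using (module RingMorphisms)
import Algebra.Properties.CommutativeMonoid.Sum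
import Algebra.Properties.CommutativeSemigroup
import Algebra.Properties.Group
import Algebra.Properties.Ring
import Algebra.Properties.Semiring.Exp
import Algebra.Properties.Semiring.Sum
import Algebra.Solver.CommutativeMonoid
import Algebra.Solver.Ring
open import Algebra.Solver.Ring.AlmostCommutativeRing
  using (_-Raw-AlmostCommutative⟶_; Induced-equivalence; fromCommutativeRing)
open import Data.Bool.Base using (Bool; false; true)
import Data.Bool.Properties as Bool
open import Data.Fin.Base using (Fin; zero; suc; combine; fromℕ<; punchIn; toℕ; _↑ˡ_; _↑ʳ_)
open import Data.Fin.Patterns
open import Data.Fin.Permutation using (Permutation; permutation; _⟨$⟩ʳ_)
import Data.Fin.Properties as Fin
import Data.Integer.Base
open import Data.Integer.Base as ℤ using (ℤ; +_; -1ℤ)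
open import Data.Integer.Divisibility.Signed using (_∣_; divides; ∣m∣n⇒∣m+n; ∣m∣n⇒∣m-n; ∣m⇒∣m*n; ∣n⇒∣m*n)
import Data.Integer.DivMod as ℤ
import Data.Integer.Properties as ℤ
import Data.Integer.Solver
import Data.Maybe.Base as Maybe
open import Data.Nat.Base as ℕ using (ℕ; zero; suc; NonZero; s<s; s≤s)
open import Data.Nat.DivMod using (_%_; _/_; _mod_; m%n<n; m%n%n≡m%n; m≡m%n+[m/n]*n; %-distribˡ-*)
import Data.Nat.Properties as ℕ
open import Data.Product.Base using (_,_; _×_; ∃; proj₁; proj₂; uncurry)
open import Data.Sum.Base as Sum using (_⊎_; inj₁; inj₂)
open import Data.Vec.Base using (Vec; []; _∷_; count; insertAt; lookup; replicate)
open import Data.Vec.Functional using (tail)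
open import Defs
open import Function.Base using (_∘_; _$_; id)
open import Function.Bundles using (Func; Inverse)
open import Level using (0ℓ)
open import Relation.Binary.Consequences using (dec⇒weaklyDec)
open import Relation.Binary.Definitions using (WeaklyDecidable)
open import Relation.Binary.PropositionalEquality as ≡ using (_≡_; _≢_)
import Relation.Binary.Reasoning.Setoid
open import Relation.Nullary.Decidable using (from-yes; _⊎-dec_)
open import Relation.Nullary.Negation using (¬_; contradiction)
open import Relation.Unary using (_∪_; _≐_)

open Algebra.Properties.CommutativeMonoid.Sum ℤ.+-0-commutativeMonoid using () renaming (sum to ℤsum)
open Algebra.Properties.CommutativeMonoid.Sum ℤ.*-1-commutativeMonoid using () renaming (sum to ℤproduct)

-- The classes ±1 and ±7 are the fourth roots of unity modulo 25, that is, the values of s²⁵ for s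
-- prime to 5.
--
-- In ℤ[ζ] the prime above 5 is generated by π = 1 - ζ, of norm 5. An element whose coefficient sum
-- is divisible by 5 lies in (π), and up to sign the first moment is its next π-adic coefficient;
-- this is where the factors 5 and 25 of the norms come from. No ideals are needed: the norm is an
-- explicit integer polynomial in the coefficients, and divisibility is settled in ℤ.
--
-- Elements of ℤ[C₅] are represented by their values at all five characters. The trivial one has to
-- be included, because it carries the coefficient sum on which the congruence modulo 25 depends.
--
-- Diagonalisation needs a multiplicative determinant, whereas `det` is a cofactor expansion; the
-- exterior algebra connects the two. The character matrix is invertible only up to a power of 25,
-- so the product formula holds at first only after multiplication by 25²⁵. That factor is cancelled
-- in ℤ[ζ], which is free over ℤ.

-- Pushforwards and norm forms with integer coefficients.

δ : ∀ {n} → Fin n → Fin n → ℤ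
δ zero    zero    = + 1
δ zero    (suc j) = + 0
δ (suc i) zero    = + 0
δ (suc i) (suc j) = δ i j

δ-≢ : ∀ {n} (i j : Fin n) → i ≢ j → δ i j ≡ + 0
δ-≢ zero    zero    i≢j with () ← i≢j ≡.refl
δ-≢ zero    (suc j) i≢j = ≡.refl
δ-≢ (suc i) zero    i≢j = ≡.refl
δ-≢ (suc i) (suc j) i≢j = δ-≢ i j (i≢j ∘ ≡.cong suc)

δ-refl : ∀ {n} (i : Fin n) → δ i i ≡ + 1
δ-refl zero    = ≡.refl
δ-refl (suc i) = δ-refl i

δ-sym : ∀ {n} (i j : Fin n) → δ i j ≡ δ j i
δ-sym zero    zero    = ≡.refl
δ-sym zero    (suc j) = ≡.refl
δ-sym (suc i) zero    = ≡.refl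
δ-sym (suc i) (suc j) = δ-sym i j

-- The pushforward of `α` along `φ`. For a linear form `φ` it collapses C₅ × C₅ to C₅; for addition
-- in a cyclic group and `α i j = r i * s j` it is the convolution of `r` and `s`.
fibreSum : ∀ {m n k} → (Fin m → Fin n → Fin k) → (Fin m → Fin n → ℤ) → Fin k → ℤ
fibreSum φ α x = ℤsum λ i → ℤsum λ j → δ (φ i j) x ℤ.* α i j

-- σ⁴ + 5ρ is the norm of Σ xᵢζⁱ, written in the sum of the xᵢ and their cyclic correlations.
module Forms {c ℓ} (R : RawRing c ℓ) where
  open RawRing R

  σ β γ ρ : (Fin 5 → Carrier) → Carrier
  σ x = x 0F + x 1F + x 2F + x 3F + x 4F
  β x = x 0F * x 1F + x 1F * x 2F + x 2F * x 3F + x 3F * x 4F + x 4F * x 0F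
  γ x = x 0F * x 2F + x 1F * x 3F + x 2F * x 4F + x 3F * x 0F + x 4F * x 1F
  ρ x = (β x + γ x) * (β x + γ x) + β x * γ x + - (σ x * σ x * (β x + γ x))

module Fℤ = Forms (CommutativeRing.rawRing ℤ.+-*-commutativeRing)

νℤ : (Fin 5 → ℤ) → ℤ
νℤ x = Fℤ.σ x ℤ.* Fℤ.σ x ℤ.* Fℤ.σ x ℤ.* Fℤ.σ x ℤ.+ + 5 ℤ.* Fℤ.ρ x

total : (Fin 5 → Fin 5 → ℤ) → ℤ
total α = ℤsum λ i → ℤsum λ j → α i j

-- The nontrivial characters of C₅ × C₅ fall into six Galois orbits, one for each
-- of the linear forms i + lj and j; the orbit of a form is the set of its multiples.
form : Fin 5 → Fin 5 → Fin 5 → Fin 5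
form l i j = (toℕ i ℕ.+ toℕ l ℕ.* toℕ j) mod 5

orbitNorm : (Fin 5 → Fin 5 → ℤ) → Fin 5 → ℤ
orbitNorm α l = νℤ (fibreSum (form l) α)

orbitNorm∞ : (Fin 5 → Fin 5 → ℤ) → ℤ
orbitNorm∞ α = νℤ (fibreSum (λ i j → j) α)

orbitNorms : (Fin 5 → Fin 5 → ℤ) → ℤ
orbitNorms α = orbitNorm∞ α ℤ.* ℤproduct (orbitNorm α)

shift : ℤ → (Fin 5 → ℤ) → Fin 5 → ℤ
shift c r 0F      = c ℤ.+ + 5 ℤ.* r 0F
shift c r (suc j) = + 5 ℤ.* r (suc j)

module _ {c ℓ} (M : CommutativeMonoid c ℓ) where
  open CommutativeMonoid M
  open Algebra.Properties.CommutativeMonoid.Sum M using (sum)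
  open Relation.Binary.Reasoning.Setoid setoid

  sum-↑ : ∀ m n (f : Fin (m ℕ.+ n) → Carrier) → sum f ≈ sum (λ i → f (i ↑ˡ n)) ∙ sum (λ j → f (m ↑ʳ j))
  sum-↑ zero    n f = sym (identityˡ _)
  sum-↑ (suc m) n f = trans (∙-congˡ (sum-↑ m n (f ∘ suc))) (sym (assoc _ _ _))

  sum-combine : ∀ m n (f : Fin (m ℕ.* n) → Carrier) → sum f ≈ sum {m} λ i → sum {n} λ j → f (combine i j)
  sum-combine zero    n f = refl
  sum-combine (suc m) n f = trans (sum-↑ n (m ℕ.* n) f) (∙-congˡ (sum-combine m n (λ k → f (n ↑ʳ k))))

module FromIntegers {c ℓ} (R : CommutativeRing c ℓ) (ι : ℤ → CommutativeRing.Carrier R)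
  (ι-hom : RingMorphisms.IsRingHomomorphism (CommutativeRing.rawRing ℤ.+-*-commutativeRing)
             (CommutativeRing.rawRing R) ι) where

  open CommutativeRing R hiding (zero)
  open RingMorphisms.IsRingHomomorphism ι-hom
    using (+-homo; *-homo; -‿homo; 0#-homo; 1#-homo)
  open Algebra.Properties.Ring ring using (-0#≈0#)
  open Algebra.Properties.Semiring.Exp semiring
    using (_^_; ^-homo-*; ^-assocʳ; ^-congˡ; ^-congʳ)
  open Algebra.Properties.Semiring.Sum semiring
    using (sum; sum-cong-≋; sum-permute; sum-replicate-zero; ∑-comm; ∑-distrib-+; *-distribˡ-sum; *-distribʳ-sum)
  open Algebra.Properties.CommutativeMonoid.Sum *-commutativeMonoid
    using () renaming (sum to product; sum-cong-≋ to product-cong; ∑-comm to ∏-comm)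
  open Relation.Binary.Reasoning.Setoid setoid

  ι-morphism : CommutativeRing.rawRing ℤ.+-*-commutativeRing -Raw-AlmostCommutative⟶ fromCommutativeRing R
  ι-morphism = record
    { ⟦_⟧    = ι
    ; +-homo = +-homo
    ; *-homo = *-homo
    ; -‿homo = -‿homo
    ; 0-homo = 0#-homo
    ; 1-homo = 1#-homo
    }

  ι-≟ : WeaklyDecidable (Induced-equivalence ι-morphism)
  ι-≟ m n = Maybe.map (reflexive ∘ ≡.cong ι) (dec⇒weaklyDec ℤ._≟_ m n)

  module Solver = Algebra.Solver.Ring (CommutativeRing.rawRing ℤ.+-*-commutativeRing) (fromCommutativeRing R) ι-morphism ι-≟

  open Solver using (solve; _:+_; _:*_; _:-_; _:^_; :-_; con; _:=_)

  ι-sum : ∀ {n} (f : Fin n → ℤ) → ι (ℤsum f) ≈ sum (ι ∘ f)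
  ι-sum {zero}  f = 0#-homo
  ι-sum {suc n} f = trans (+-homo _ _) (+-congˡ (ι-sum (f ∘ suc)))

  -- Exterior algebra and multiplicativity of the determinant.

  -- An element of the exterior algebra of Rⁿ is given by its coordinates in
  -- the basis of products of basis vectors, indexed by subsets of Fin n.
  Λ : ℕ → Set c
  Λ n = Vec Bool n → Carrier

  infix 4 _≗_
  _≗_ : ∀ {n} → Λ n → Λ n → Set ℓ
  ω ≗ η = ∀ S → ω S ≈ η S

  one : ∀ {n} → Λ n
  one []          = 1#
  one (false ∷ S) = one S
  one (true  ∷ S) = 0#

  infixr 8 _∧_
  -- Left multiplication by a vector suffices to build all products of rows. The minus sign in the
  -- `true` clause comes from moving the remaining coordinates of `v` past the basis vector at
  -- `zero`.
  _∧_ : ∀ {n} → (Fin n → Carrier) → Λ n → Λ n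
  (v ∧ ω) []          = 0#
  (v ∧ ω) (false ∷ S) = (tail v ∧ ω ∘ (false ∷_)) S
  (v ∧ ω) (true  ∷ S) = v zero * ω (false ∷ S) - (tail v ∧ ω ∘ (true ∷_)) S

  ∧-cong : ∀ {n} {v w : Fin n → Carrier} {ω η : Λ n} →
           (∀ i → v i ≈ w i) → ω ≗ η → v ∧ ω ≗ w ∧ η
  ∧-cong v≈w ω≗η []          = refl
  ∧-cong v≈w ω≗η (false ∷ S) = ∧-cong (v≈w ∘ suc) (ω≗η ∘ (false ∷_)) S
  ∧-cong v≈w ω≗η (true  ∷ S) = +-cong (*-cong (v≈w zero) (ω≗η _))
    (-‿cong (∧-cong (v≈w ∘ suc) (ω≗η ∘ (true ∷_)) S))

  ∧-zeroˡ : ∀ {n} (ω : Λ n) S → ((λ _ → 0#) ∧ ω) S ≈ 0#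
  ∧-zeroˡ ω []          = refl
  ∧-zeroˡ ω (false ∷ S) = ∧-zeroˡ (ω ∘ (false ∷_)) S
  ∧-zeroˡ ω (true  ∷ S) = begin
    0# * ω (false ∷ S) - _ ≈⟨ +-cong (zeroˡ _) (-‿cong (∧-zeroˡ (ω ∘ (true ∷_)) S)) ⟩
    0# - 0#                ≈⟨ -‿inverseʳ 0# ⟩
    0#                     ∎

  ∧-linearˡ : ∀ {n} r (v w : Fin n → Carrier) (ω : Λ n) S →
              ((λ i → r * v i + w i) ∧ ω) S ≈ r * (v ∧ ω) S + (w ∧ ω) S
  ∧-linearˡ r v w ω []          = sym (trans (+-identityʳ _) (zeroʳ r))
  ∧-linearˡ r v w ω (false ∷ S) = ∧-linearˡ r (tail v) (tail w) (ω ∘ (false ∷_)) S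
  ∧-linearˡ r v w ω (true  ∷ S) =
    trans (+-congˡ (-‿cong (∧-linearˡ r (tail v) (tail w) (ω ∘ (true ∷_)) S)))
      (solve 6 (λ r v w x y z → (r :* v :+ w) :* x :- (r :* y :+ z)
                 := r :* (v :* x :- y) :+ (w :* x :- z)) refl r _ _ _ _ _)

  ∧-linearʳ : ∀ {n} r s (v : Fin n → Carrier) (ω η : Λ n) S →
              (v ∧ (λ T → r * ω T + s * η T)) S ≈ r * (v ∧ ω) S + s * (v ∧ η) S
  ∧-linearʳ r s v ω η []          = sym (trans (+-cong (zeroʳ r) (zeroʳ s)) (+-identityʳ 0#))
  ∧-linearʳ r s v ω η (false ∷ S) = ∧-linearʳ r s (tail v) (ω ∘ (false ∷_)) (η ∘ (false ∷_)) S
  ∧-linearʳ r s v ω η (true  ∷ S) =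
    trans (+-congˡ (-‿cong (∧-linearʳ r s (tail v) (ω ∘ (true ∷_)) (η ∘ (true ∷_)) S)))
      (solve 7 (λ r s v x y p q → v :* (r :* x :+ s :* y) :- (r :* p :+ s :* q)
                 := r :* (v :* x :- p) :+ s :* (v :* y :- q)) refl r s _ _ _ _ _)

  -- The combination `r * ω T - η T` is the shape of the `true` clause of `_∧_`, so this moves one
  -- wedge through another in the inductions below.
  ∧-sub : ∀ {n} r (v : Fin n → Carrier) (ω η : Λ n) S →
          (v ∧ (λ T → r * ω T - η T)) S ≈ r * (v ∧ ω) S - (v ∧ η) S
  ∧-sub r v ω η S = begin
    (v ∧ (λ T → r * ω T - η T)) S        ≈⟨ ∧-cong (λ _ → refl) (λ T → -1* r (ω T) (η T)) S ⟩
    (v ∧ (λ T → r * ω T + ι -1ℤ * η T)) S ≈⟨ ∧-linearʳ r (ι -1ℤ) v ω η S ⟩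
    r * (v ∧ ω) S + ι -1ℤ * (v ∧ η) S      ≈⟨ -1* r _ _ ⟨
    r * (v ∧ ω) S - (v ∧ η) S            ∎
    where
    -1* : ∀ r x y → r * x - y ≈ r * x + ι -1ℤ * y
    -1* = solve 3 (λ r x y → r :* x :- y := r :* x :+ con -1ℤ :* y) refl

  ∧-distribˡ : ∀ {n} (v : Fin n → Carrier) (ω η : Λ n) S →
               (v ∧ (λ T → ω T + η T)) S ≈ (v ∧ ω) S + (v ∧ η) S
  ∧-distribˡ v ω η S = begin
    (v ∧ (λ T → ω T + η T)) S            ≈⟨ ∧-cong (λ _ → refl) (λ T → 1* (ω T) (η T)) S ⟩
    (v ∧ (λ T → 1# * ω T + 1# * η T)) S  ≈⟨ ∧-linearʳ 1# 1# v ω η S ⟩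
    1# * (v ∧ ω) S + 1# * (v ∧ η) S      ≈⟨ 1* _ _ ⟨
    (v ∧ ω) S + (v ∧ η) S                ∎
    where
    1* : ∀ x y → x + y ≈ 1# * x + 1# * y
    1* x y = sym (+-cong (*-identityˡ x) (*-identityˡ y))

  ∧-scale : ∀ {n} r (v : Fin n → Carrier) (ω : Λ n) S →
            (v ∧ (λ T → r * ω T)) S ≈ r * (v ∧ ω) S
  ∧-scale r v ω S = begin
    (v ∧ (λ T → r * ω T)) S             ≈⟨ ∧-cong (λ _ → refl) (λ T → +0 (ω T)) S ⟩
    (v ∧ (λ T → r * ω T + 0# * ω T)) S  ≈⟨ ∧-linearʳ r 0# v ω ω S ⟩
    r * (v ∧ ω) S + 0# * (v ∧ ω) S      ≈⟨ +0 _ ⟨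
    r * (v ∧ ω) S                       ∎
    where
    +0 : ∀ x → r * x ≈ r * x + 0# * x
    +0 x = sym (trans (+-congˡ (zeroˡ x)) (+-identityʳ _))

  -- Proved separately from `∧-anticomm`, which would only show that twice the product vanishes.
  ∧-square : ∀ {n} (v : Fin n → Carrier) (ω : Λ n) S → (v ∧ v ∧ ω) S ≈ 0#
  ∧-square v ω []          = refl
  ∧-square v ω (false ∷ S) = ∧-square (tail v) (ω ∘ (false ∷_)) S
  ∧-square v ω (true  ∷ S) = begin
    v zero * x - (tail v ∧ (v ∧ ω) ∘ (true ∷_)) S
      ≈⟨ +-congˡ (-‿cong (∧-sub (v zero) (tail v) (ω ∘ (false ∷_)) _ S)) ⟩
    v zero * x - (v zero * x - (tail v ∧ tail v ∧ ω ∘ (true ∷_)) S)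
      ≈⟨ +-congˡ (-‿cong (+-congˡ (-‿cong (∧-square (tail v) (ω ∘ (true ∷_)) S)))) ⟩
    v zero * x - (v zero * x - 0#)
      ≈⟨ solve 3 (λ v x z → v :* x :- (v :* x :- z) := z) refl (v zero) x 0# ⟩
    0# ∎
    where
    x = (tail v ∧ ω ∘ (false ∷_)) S

  ∧-anticomm : ∀ {n} (v w : Fin n → Carrier) (ω : Λ n) S → (v ∧ w ∧ ω) S + (w ∧ v ∧ ω) S ≈ 0#
  ∧-anticomm v w ω []          = +-identityʳ 0#
  ∧-anticomm v w ω (false ∷ S) = ∧-anticomm (tail v) (tail w) (ω ∘ (false ∷_)) S
  ∧-anticomm v w ω (true  ∷ S) = begin
    v₀ * y - (tail v ∧ (w ∧ ω) ∘ (true ∷_)) S + (w₀ * x - (tail w ∧ (v ∧ ω) ∘ (true ∷_)) S)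
      ≈⟨ +-cong (+-congˡ (-‿cong (∧-sub w₀ (tail v) (ω ∘ (false ∷_)) _ S)))
                (+-congˡ (-‿cong (∧-sub v₀ (tail w) (ω ∘ (false ∷_)) _ S))) ⟩
    v₀ * y - (w₀ * x - p) + (w₀ * x - (v₀ * y - q))
      ≈⟨ solve 6 (λ v w x y p q → v :* y :- (w :* x :- p) :+ (w :* x :- (v :* y :- q)) := p :+ q)
           refl v₀ w₀ x y p q ⟩
    p + q
      ≈⟨ ∧-anticomm (tail v) (tail w) (ω ∘ (true ∷_)) S ⟩
    0# ∎
    where
    v₀ = v zero
    w₀ = w zero
    x = (tail v ∧ ω ∘ (false ∷_)) S
    y = (tail w ∧ ω ∘ (false ∷_)) S
    p = (tail v ∧ tail w ∧ ω ∘ (true ∷_)) S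
    q = (tail w ∧ tail v ∧ ω ∘ (true ∷_)) S

  ⋀ : ∀ {k n} → (Fin k → Fin n → Carrier) → Λ n
  ⋀ {zero}  A = one
  ⋀ {suc k} A = A zero ∧ ⋀ (tail A)

  ⋀-cong : ∀ {k n} {A B : Fin k → Fin n → Carrier} → (∀ i j → A i j ≈ B i j) → ⋀ A ≗ ⋀ B
  ⋀-cong {zero}  A≈B S = refl
  ⋀-cong {suc k} A≈B   = ∧-cong (A≈B zero) (⋀-cong (A≈B ∘ suc))

  full : ∀ n → Vec Bool n
  full n = replicate n true

  Det : ∀ {n} → (Fin n → Fin n → Carrier) → Carrier
  Det {n} A = ⋀ A (full n)

  -- A coefficient at a subset avoiding `j` never involves coordinate `j`, so column `j` can be
  -- deleted. Iterated over the rows, this identifies the coefficients of `⋀` at corank one with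
  -- minors.
  ∧-insertAt : ∀ {n} (v : Fin (suc n) → Carrier) (ω : Λ (suc n)) j S →
               (v ∧ ω) (insertAt S j false) ≈ (v ∘ punchIn j ∧ (λ T → ω (insertAt T j false))) S
  ∧-insertAt v ω zero    S           = refl
  ∧-insertAt v ω (suc j) (false ∷ S) = ∧-insertAt (tail v) (ω ∘ (false ∷_)) j S
  ∧-insertAt v ω (suc j) (true  ∷ S) = +-congˡ (-‿cong (∧-insertAt (tail v) (ω ∘ (true ∷_)) j S))

  one-insertAt : ∀ {n} j (S : Vec Bool n) → one (insertAt S j false) ≈ one S
  one-insertAt zero    S           = refl
  one-insertAt (suc j) (false ∷ S) = one-insertAt j S
  one-insertAt (suc j) (true  ∷ S) = refl

  ⋀-insertAt : ∀ {k n} (A : Fin k → Fin (suc n) → Carrier) j S →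
               ⋀ A (insertAt S j false) ≈ ⋀ (λ i → A i ∘ punchIn j) S
  ⋀-insertAt {zero}  A j S = one-insertAt j S
  ⋀-insertAt {suc k} A j S =
    trans (∧-insertAt (A zero) _ j S) (∧-cong (λ _ → refl) (⋀-insertAt (tail A) j) S)

  -- Cofactor expansion along the first row: the alternating signs accumulate from the minus sign in
  -- the recursion of `_∧_`.
  ∧-full : ∀ {n} (v : Fin (suc n) → Carrier) (ω : Λ (suc n)) →
           (v ∧ ω) (full (suc n)) ≈
           sum λ j → ι (-1ℤ ℤ.^ toℕ j) * v j * ω (insertAt (full n) j false)
  ∧-full {zero}  v ω = begin
    v zero * ω (false ∷ []) - 0#
      ≈⟨ +-congˡ -0#≈0# ⟩
    v zero * ω (false ∷ []) + 0#
      ≈⟨ +-congʳ (solve 2 (λ v x → v :* x := con (+ 1) :* v :* x) refl (v zero) _) ⟩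
    ι (+ 1) * v zero * ω (false ∷ []) + 0# ∎
  ∧-full {suc n} v ω = begin
    v zero * x - (tail v ∧ ω ∘ (true ∷_)) (full (suc n))
      ≈⟨ +-congˡ (-‿cong (∧-full (tail v) (ω ∘ (true ∷_)))) ⟩
    v zero * x - sum f
      ≈⟨ solve 3 (λ v x s → v :* x :- s := con (+ 1) :* v :* x :+ con -1ℤ :* s) refl (v zero) x (sum f) ⟩
    ι (+ 1) * v zero * x + ι -1ℤ * sum f
      ≈⟨ +-congˡ (*-distribˡ-sum (ι -1ℤ) f) ⟩
    ι (+ 1) * v zero * x + sum (λ j → ι -1ℤ * f j)
      ≈⟨ +-congˡ (sum-cong-≋ λ j → assoc₃ j) ⟩
    ι (+ 1) * v zero * x + sum (λ j → ι (-1ℤ ℤ.* -1ℤ ℤ.^ toℕ j) * v (suc j)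
                                        * ω (true ∷ insertAt (full n) j false)) ∎
    where
    x = ω (false ∷ full (suc n))
    f : Fin (suc n) → Carrier
    f j = ι (-1ℤ ℤ.^ toℕ j) * v (suc j) * ω (true ∷ insertAt (full n) j false)
    assoc₃ : ∀ j → ι -1ℤ * f j ≈ ι (-1ℤ ℤ.* -1ℤ ℤ.^ toℕ j) * v (suc j) * ω (true ∷ insertAt (full n) j false)
    assoc₃ j = begin
      ι -1ℤ * f j
        ≈⟨ solve 4 (λ a b c d → a :* (b :* c :* d) := a :* b :* c :* d) refl _ _ _ _ ⟩
      ι -1ℤ * ι (-1ℤ ℤ.^ toℕ j) * v (suc j) * ω (true ∷ insertAt (full n) j false)
        ≈⟨ *-congʳ (*-congʳ (*-homo _ _)) ⟨
      ι (-1ℤ ℤ.* -1ℤ ℤ.^ toℕ j) * v (suc j) * ω (true ∷ insertAt (full n) j false) ∎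

  ι-det : ∀ {n} (A : Matrix n) → ι (det A) ≈ Det (λ i j → ι (A i j))
  ι-det {zero}  A = 1#-homo
  ι-det {suc n} A = begin
    ι (det A)
      ≈⟨ ι-sum (λ j → sign j ℤ.* A zero j ℤ.* minor j) ⟩
    sum (λ j → ι (sign j ℤ.* A zero j ℤ.* minor j))
      ≈⟨ sum-cong-≋ term ⟩
    sum (λ j → ι (sign j) * ι (A zero j) * ⋀ ιA′ (insertAt (full n) j false))
      ≈⟨ ∧-full (λ j → ι (A zero j)) (⋀ ιA′) ⟨
    Det (λ i j → ι (A i j)) ∎
    where
    sign minor : Fin (suc n) → ℤ
    sign j  = -1ℤ ℤ.^ toℕ j
    minor j = det λ i k → A (suc i) (punchIn j k)
    ιA′ : Fin n → Fin (suc n) → Carrier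
    ιA′ i k = ι (A (suc i) k)
    term : ∀ j → ι (sign j ℤ.* A zero j ℤ.* minor j) ≈
                 ι (sign j) * ι (A zero j) * ⋀ ιA′ (insertAt (full n) j false)
    term j = begin
      ι (sign j ℤ.* A zero j ℤ.* minor j)        ≈⟨ *-homo (sign j ℤ.* A zero j) (minor j) ⟩
      ι (sign j ℤ.* A zero j) * ι (minor j)      ≈⟨ *-cong (*-homo (sign j) (A zero j)) (ι-det λ i k → A (suc i) (punchIn j k)) ⟩
      ι (sign j) * ι (A zero j) * Det (λ i k → ιA′ i (punchIn j k))
        ≈⟨ *-congˡ (⋀-insertAt ιA′ j (full n)) ⟨
      ι (sign j) * ι (A zero j) * ⋀ ιA′ (insertAt (full n) j false) ∎

  Det-diagonal : ∀ {n} (A : Fin n → Fin n → Carrier) → (∀ i j → i ≢ j → A i j ≈ 0#) →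
                 Det A ≈ product λ i → A i i
  Det-diagonal {zero}  A offdiag = refl
  Det-diagonal {suc n} A offdiag = begin
    A zero zero * ⋀ (tail A) (false ∷ full n) - (tail (A zero) ∧ _) (full n)
      ≈⟨ +-cong (*-congˡ (⋀-insertAt (tail A) zero (full n)))
          (-‿cong (trans (∧-cong (λ j → offdiag zero (suc j) λ ()) (λ _ → refl) (full n)) (∧-zeroˡ _ (full n)))) ⟩
    A zero zero * Det (λ i j → A (suc i) (suc j)) - 0#
      ≈⟨ +-cong (*-congˡ (Det-diagonal _ λ i j i≢j → offdiag (suc i) (suc j) λ where ≡.refl → i≢j ≡.refl))
           -0#≈0# ⟩
    A zero zero * product (λ i → A (suc i) (suc i)) + 0#
      ≈⟨ +-identityʳ _ ⟩
    A zero zero * product (λ i → A (suc i) (suc i)) ∎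

  -- The algebra homomorphism Λ Rⁿ → Λ Rᵐ that sends the basis vectors to the rows of B.
  map : ∀ {n m} → (Fin n → Fin m → Carrier) → Λ n → Λ m
  map {zero}  B ω S = ω [] * one S
  map {suc n} B ω S = map (tail B) (ω ∘ (false ∷_)) S + (B zero ∧ map (tail B) (ω ∘ (true ∷_))) S

  map-zero : ∀ {n m} (B : Fin n → Fin m → Carrier) {ω : Λ n} → (∀ S → ω S ≈ 0#) → ∀ S → map B ω S ≈ 0#
  map-zero {zero}  B ω≗0 S = trans (*-congʳ (ω≗0 [])) (zeroˡ _)
  map-zero {suc n} B ω≗0 S = begin
    map (tail B) _ S + (B zero ∧ map (tail B) _) S
      ≈⟨ +-cong (map-zero (tail B) (ω≗0 ∘ (false ∷_)) S)
           (∧-cong (λ _ → refl) (λ T → trans (map-zero (tail B) (ω≗0 ∘ (true ∷_)) T) (sym (zeroˡ 0#))) S) ⟩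
    -- Zero is written as `0# * 0#` so that `∧-scale` can extract a vanishing factor.
    0# + (B zero ∧ (λ _ → 0# * 0#)) S
      ≈⟨ +-congˡ (trans (∧-scale 0# (B zero) (λ _ → 0#) S) (zeroˡ _)) ⟩
    0# + 0# ≈⟨ +-identityʳ 0# ⟩
    0# ∎

  map-sub : ∀ {n m} (B : Fin n → Fin m → Carrier) r (ω η : Λ n) S →
            map B (λ T → r * ω T - η T) S ≈ r * map B ω S - map B η S
  map-sub {zero}  B r ω η S =
    solve 4 (λ r x y o → (r :* x :- y) :* o := r :* (x :* o) :- y :* o) refl r _ _ _
  map-sub {suc n} B r ω η S = begin
    map (tail B) _ S + (B zero ∧ map (tail B) _) S
      ≈⟨ +-cong (map-sub (tail B) r _ _ S) (∧-cong (λ _ → refl) (map-sub (tail B) r _ _) S) ⟩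
    (r * a - b) + (B zero ∧ (λ T → r * map (tail B) (ω ∘ (true ∷_)) T - map (tail B) (η ∘ (true ∷_)) T)) S
      ≈⟨ +-congˡ (∧-sub r (B zero) _ _ S) ⟩
    (r * a - b) + (r * c′ - d)
      ≈⟨ solve 5 (λ r a b c d → (r :* a :- b) :+ (r :* c :- d) := r :* (a :+ c) :- (b :+ d)) refl r a b c′ d ⟩
    r * (a + c′) - (b + d) ∎
    where
    a = map (tail B) (ω ∘ (false ∷_)) S
    b = map (tail B) (η ∘ (false ∷_)) S
    c′ = (B zero ∧ map (tail B) (ω ∘ (true ∷_))) S
    d = (B zero ∧ map (tail B) (η ∘ (true ∷_))) S

  -- The only place where alternation enters. The terms `b ∧ b ∧ Q` and `b ∧ x ∧ Q + x ∧ b ∧ Q`,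
  -- which complete the expected product, are added and subtracted, and the subtracted copies vanish
  -- by `∧-square` and `∧-anticomm`.
  map-∧ : ∀ {n m} (B : Fin n → Fin m → Carrier) v (ω : Λ n) S →
          map B (v ∧ ω) S ≈ ((λ c → sum λ k → v k * B k c) ∧ map B ω) S
  map-∧ {zero}  B v ω S = trans (zeroˡ _) (sym (∧-zeroˡ _ S))
  map-∧ {suc n} B v ω S = begin
    map B′ (tail v ∧ ω₀) S + (b ∧ map B′ (λ T → v zero * ω₀ T - (tail v ∧ ω₁) T)) S
      ≈⟨ +-cong (map-∧ B′ (tail v) ω₀ S)
           (∧-cong (λ _ → refl) (λ T → trans (map-sub B′ (v zero) ω₀ _ T) (+-congˡ (-‿cong (map-∧ B′ (tail v) ω₁ T)))) S) ⟩
    (x ∧ P) S + (b ∧ (λ T → v zero * P T - (x ∧ Q) T)) S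
      ≈⟨ +-congˡ (∧-sub (v zero) b P _ S) ⟩
    (x ∧ P) S + (v zero * (b ∧ P) S - (b ∧ x ∧ Q) S)
      ≈⟨ solve 6 (λ xP v bP bbQ bxQ xbQ → xP :+ (v :* bP :- bxQ)
                   := v :* (bP :+ bbQ) :+ (xP :+ xbQ) :- (v :* bbQ :+ (bxQ :+ xbQ))) refl
           ((x ∧ P) S) (v zero) ((b ∧ P) S) ((b ∧ b ∧ Q) S) ((b ∧ x ∧ Q) S) ((x ∧ b ∧ Q) S) ⟩
    v zero * ((b ∧ P) S + (b ∧ b ∧ Q) S) + ((x ∧ P) S + (x ∧ b ∧ Q) S)
      - (v zero * (b ∧ b ∧ Q) S + ((b ∧ x ∧ Q) S + (x ∧ b ∧ Q) S))
      ≈⟨ +-congˡ (-‿cong (trans (+-cong (trans (*-congˡ (∧-square b Q S)) (zeroʳ _)) (∧-anticomm b x Q S)) (+-identityʳ 0#))) ⟩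
    v zero * ((b ∧ P) S + (b ∧ b ∧ Q) S) + ((x ∧ P) S + (x ∧ b ∧ Q) S) - 0#
      ≈⟨ trans (+-congˡ -0#≈0#) (+-identityʳ _) ⟩
    v zero * ((b ∧ P) S + (b ∧ b ∧ Q) S) + ((x ∧ P) S + (x ∧ b ∧ Q) S)
      ≈⟨ +-cong (*-congˡ (∧-distribˡ b P _ S)) (∧-distribˡ x P _ S) ⟨
    v zero * (b ∧ map B ω) S + (x ∧ map B ω) S
      ≈⟨ ∧-linearˡ (v zero) b x (map B ω) S ⟨
    ((λ c → sum λ k → v k * B k c) ∧ map B ω) S ∎
    where
    B′ = tail B
    b  = B zero
    ω₀ = ω ∘ (false ∷_)
    ω₁ = ω ∘ (true ∷_)
    P  = map B′ ω₀
    Q  = map B′ ω₁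
    x  = λ c → sum λ k → v (suc k) * B (suc k) c

  map-one : ∀ {n m} (B : Fin n → Fin m → Carrier) S → map B one S ≈ one S
  map-one {zero}  B S = *-identityˡ _
  map-one {suc n} B S = begin
    map (tail B) one S + (B zero ∧ map (tail B) (λ _ → 0#)) S
      ≈⟨ +-cong (map-one (tail B) S)
           (∧-cong (λ _ → refl) (λ T → trans (map-zero (tail B) (λ _ → refl) T) (sym (zeroˡ 0#))) S) ⟩
    one S + (B zero ∧ (λ _ → 0# * 0#)) S
      ≈⟨ +-congˡ (trans (∧-scale 0# (B zero) (λ _ → 0#) S) (zeroˡ _)) ⟩
    one S + 0# ≈⟨ +-identityʳ _ ⟩
    one S ∎

  infixl 7 _⊗_
  _⊗_ : ∀ {k n m} → (Fin k → Fin n → Carrier) → (Fin n → Fin m → Carrier) → Fin k → Fin m → Carrier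
  (A ⊗ B) i j = sum λ k → A i k * B k j

  map-⋀ : ∀ {k n m} (A : Fin k → Fin n → Carrier) (B : Fin n → Fin m → Carrier) → map B (⋀ A) ≗ ⋀ (A ⊗ B)
  map-⋀ {zero}  A B S = map-one B S
  map-⋀ {suc k} A B S =
    trans (map-∧ B (A zero) (⋀ (tail A)) S) (∧-cong (λ _ → refl) (map-⋀ (tail A) B) S)

  size : ∀ {n} → Vec Bool n → ℕ
  size = count (Bool._≟ true)

  size≤n : ∀ {n} (S : Vec Bool n) → size S ℕ.≤ n
  size≤n []          = ℕ.z≤n
  size≤n (false ∷ S) = ℕ.m≤n⇒m≤1+n (size≤n S)
  size≤n (true  ∷ S) = s≤s (size≤n S)

  VanishesBelow : ∀ {n} → ℕ → Λ n → Set ℓ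
  VanishesBelow k ω = ∀ S → size S ℕ.< k → ω S ≈ 0#

  ∧-vanishesBelow : ∀ {k n} (v : Fin n → Carrier) (ω : Λ n) →
                    VanishesBelow k ω → VanishesBelow (suc k) (v ∧ ω)
  ∧-vanishesBelow v ω low []          _          = refl
  ∧-vanishesBelow v ω low (false ∷ S) <          = ∧-vanishesBelow (tail v) _ (low ∘ (false ∷_)) S <
  ∧-vanishesBelow {suc k} v ω low (true ∷ S) (s<s <) = begin
    v zero * ω (false ∷ S) - (tail v ∧ ω ∘ (true ∷_)) S
      ≈⟨ +-cong (trans (*-congˡ (low (false ∷ S) <)) (zeroʳ _))
           (-‿cong (∧-vanishesBelow (tail v) _ (λ T <′ → low (true ∷ T) (s<s <′)) S <)) ⟩
    0# - 0# ≈⟨ -‿inverseʳ 0# ⟩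
    0# ∎

  ⋀-vanishesBelow : ∀ {k n} (A : Fin k → Fin n → Carrier) → VanishesBelow k (⋀ A)
  ⋀-vanishesBelow {suc k} A = ∧-vanishesBelow (A zero) _ (⋀-vanishesBelow (tail A))

  -- An element of `Λ n` without components of degree below n is a multiple of the product of all
  -- basis vectors, which `map B` sends to the product of the rows of `B`.
  map-top : ∀ {n m} (B : Fin n → Fin m → Carrier) (ω : Λ n) → VanishesBelow n ω →
            ∀ S → map B ω S ≈ ω (full n) * ⋀ B S
  map-top {zero}  B ω low S = refl
  map-top {suc n} B ω low S = begin
    map (tail B) _ S + (B zero ∧ map (tail B) _) S
      ≈⟨ +-cong (map-zero (tail B) (λ T → low (false ∷ T) (s≤s (size≤n T))) S)
          (∧-cong (λ _ → refl) (map-top (tail B) _ (λ T < → low (true ∷ T) (s<s <))) S) ⟩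
    0# + (B zero ∧ (λ T → ω (full (suc n)) * ⋀ (tail B) T)) S
      ≈⟨ trans (+-identityˡ _) (∧-scale _ (B zero) _ S) ⟩
    ω (full (suc n)) * ⋀ B S ∎

  -- Both sides are the top coefficient of `map B (⋀ A)`, evaluated by `map-⋀` and by `map-top`.
  Det-⊗ : ∀ {n} (A B : Fin n → Fin n → Carrier) → Det (A ⊗ B) ≈ Det A * Det B
  Det-⊗ {n} A B = trans (sym (map-⋀ A B (full n))) (map-top B (⋀ A) (⋀-vanishesBelow A) (full n))

  sum-δ : ∀ {n} i (f : Fin n → Carrier) → sum (λ k → ι (δ k i) * f k) ≈ f i
  sum-δ {suc n} zero f = begin
    ι (+ 1) * f zero + sum (λ k → ι (+ 0) * f (suc k))
      ≈⟨ +-cong (trans (*-congʳ 1#-homo) (*-identityˡ _))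
           (sum-cong-≋ λ k → trans (*-congʳ 0#-homo) (zeroˡ (f (suc k)))) ⟩
    f zero + sum {n} (λ _ → 0#)
      ≈⟨ trans (+-congˡ (sum-replicate-zero n)) (+-identityʳ _) ⟩
    f zero ∎
  sum-δ {suc n} (suc i) f = begin
    ι (+ 0) * f zero + sum (λ k → ι (δ k i) * f (suc k))
      ≈⟨ +-cong (trans (*-congʳ 0#-homo) (zeroˡ _)) (sum-δ i (f ∘ suc)) ⟩
    0# + f (suc i) ≈⟨ +-identityˡ _ ⟩
    f (suc i) ∎

  -- Diagonalisation of the group matrix by characters.

  module Dedekind (G : FiniteGroup) where

    open FiniteGroup G using (order; element; enumeration)
    module G where
      open FiniteGroup G public
      open Algebra.Properties.Group (FiniteGroup.group G) public
    open G using (_∙_; _⁻¹; ε)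

    index : G.Carrier → Fin order
    index = Inverse.from enumeration

    element-index : ∀ g → element (index g) G.≈ g
    element-index = Inverse.strictlyInverseˡ enumeration

    index-element : ∀ i → index (element i) ≡ i
    index-element = Inverse.strictlyInverseʳ enumeration

    -- The substitution k = g h⁻¹ for fixed g. It reindexes a row of the group matrix so that the
    -- character value of the family can be factored out.
    divide : Fin order → Permutation order order
    divide i = permutation
      (λ j → index (element i ∙ element j ⁻¹))
      (λ k → index (element k ⁻¹ ∙ element i))
      (λ k → ≡.trans
        (Inverse.from-cong enumeration (G.trans
          (G.∙-congˡ (G.trans (G.⁻¹-cong (element-index _)) (G.⁻¹-anti-homo-∙ _ _)))
          (G.trans (G.sym (G.assoc _ _ _))
            (G.trans (G.∙-congʳ (G.inverseʳ _)) (G.trans (G.identityˡ _) (G.⁻¹-involutive _))))))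
        (index-element k))
      (λ j → ≡.trans
        (Inverse.from-cong enumeration (G.trans
          (G.∙-congʳ (G.trans (G.⁻¹-cong (element-index _)) (G.⁻¹-anti-homo-∙ _ _)))
          (G.trans (G.assoc _ _ _)
            (G.trans (G.∙-congˡ (G.inverseˡ _)) (G.trans (G.identityʳ _) (G.⁻¹-involutive _))))))
        (index-element j))

    -- The matrix of the family a is diagonalised by the matrix of the characters,
    -- which is invertible up to the factor N by the orthogonality relations.
    Θ-product : (a : Family G) (χ : Fin order → G.Carrier → Carrier) →
                (∀ c {g h} → g G.≈ h → χ c g ≈ χ c h) →
                (∀ c g h → χ c (g ∙ h) ≈ χ c g * χ c h) →
                (N : Carrier) → sum (λ c → χ c ε) ≈ N →
                (∀ g → ¬ g G.≈ ε → sum (λ c → χ c g) ≈ 0#) →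
                ι (Θ G a) * product {order} (λ _ → N) ≈
                product (λ c → sum λ j → ι (Func.to a (element j)) * χ c (element j)) * product {order} (λ _ → N)
    Θ-product a χ χ-cong χ-∙ N orth-ε orth = begin
      ι (Θ G a) * P                ≈⟨ *-cong (ι-det (λ i j → Func.to a (element i ∙ element j ⁻¹))) (sym detVV̄) ⟩
      Det M * (Det V * Det V̄)      ≈⟨ *-assoc _ _ _ ⟨
      Det M * Det V * Det V̄        ≈⟨ *-congʳ (trans (sym (Det-⊗ M V)) (trans (⋀-cong MV≈VD (full order)) (Det-⊗ V D))) ⟩
      Det V * Det D * Det V̄        ≈⟨ solve 3 (λ x y z → x :* y :* z := y :* (x :* z)) refl _ _ _ ⟩
      Det D * (Det V * Det V̄)      ≈⟨ *-cong detD detVV̄ ⟩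
      product X * P ∎
      where
      P = product {order} λ _ → N
      M V V̄ D : Fin order → Fin order → Carrier
      X : Fin order → Carrier
      X c   = sum λ j → ι (Func.to a (element j)) * χ c (element j)
      M i j = ι (Func.to a (element i ∙ element j ⁻¹))
      V j c = χ c (element j ⁻¹)
      V̄ c j = χ c (element j)
      D k c = ι (δ k c) * X k

      MV≈VD : ∀ i c → (M ⊗ V) i c ≈ (V ⊗ D) i c
      MV≈VD i c = begin
        sum (λ j → M i j * V j c)
          ≈⟨ sum-cong-≋ {order} (λ j → *-cong
               (reflexive (≡.cong ι (Func.cong a (G.sym (element-index _)))))
               (χ-cong c (G.sym (G.trans (G.∙-congˡ (element-index _))
                  (G.trans (G.sym (G.assoc _ _ _)) (G.trans (G.∙-congʳ (G.inverseˡ _)) (G.identityˡ _))))))) ⟩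
        sum (λ j → f (divide i ⟨$⟩ʳ j))
          ≈⟨ sum-permute f (divide i) ⟨
        sum f
          ≈⟨ sum-cong-≋ {order} (λ k → trans (*-congˡ (χ-∙ c _ _))
               (solve 3 (λ x y z → x :* (y :* z) := y :* (x :* z)) refl _ _ _)) ⟩
        sum (λ k → χ c (element i ⁻¹) * (ι (Func.to a (element k)) * χ c (element k)))
          ≈⟨ *-distribˡ-sum {order} (V i c) (λ k → ι (Func.to a (element k)) * χ c (element k)) ⟨
        V i c * X c
          ≈⟨ sum-δ c (λ k → V i k * X k) ⟨
        sum (λ k → ι (δ k c) * (V i k * X k))
          ≈⟨ sum-cong-≋ {order} (λ k → solve 3 (λ x y z → x :* (y :* z) := y :* (x :* z)) refl (ι (δ k c)) (V i k) (X k)) ⟩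
        sum (λ k → V i k * D k c) ∎
        where
        f : Fin order → Carrier
        f k = ι (Func.to a (element k)) * χ c (element i ⁻¹ ∙ element k)

      detD : Det D ≈ product X
      detD = trans
        (Det-diagonal D λ i j i≢j → trans (*-congʳ (trans (reflexive (≡.cong ι (δ-≢ i j i≢j))) 0#-homo)) (zeroˡ _))
        (product-cong {order} λ i → trans (*-congʳ (trans (reflexive (≡.cong ι (δ-refl i))) 1#-homo)) (*-identityˡ _))

      VV̄ : ∀ i j → (V ⊗ V̄) i j ≈ sum (λ c → χ c (element i ⁻¹ ∙ element j))
      VV̄ i j = sum-cong-≋ {order} λ c → sym (χ-∙ c _ _)

      detVV̄ : Det V * Det V̄ ≈ P
      detVV̄ = trans (sym (Det-⊗ V V̄)) (trans
        (Det-diagonal (V ⊗ V̄) λ i j i≢j → trans (VV̄ i j) (orth _ λ g≈ε → i≢j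
          (≡.trans (≡.sym (index-element i)) (≡.trans (Inverse.from-cong enumeration
            (G.trans (G.sym (G.⁻¹-involutive _)) (G.sym (G.inverseʳ-unique _ _ g≈ε)))) (index-element j)))))
        (product-cong {order} λ i → trans (VV̄ i i) (trans (sum-cong-≋ {order} λ c → χ-cong c (G.inverseˡ _)) orth-ε)))

  -- Change of variables for pushforwards. Different weights `h` give character values, convolution
  -- products, coefficient sums (`h` constant) and first moments (`h` the inclusion of residues in
  -- ℤ).
  sum-fibreSum : ∀ {m n k} (φ : Fin m → Fin n → Fin k) α (h : Fin k → Carrier) →
                 sum (λ x → ι (fibreSum φ α x) * h x) ≈ sum λ i → sum λ j → ι (α i j) * h (φ i j)
  sum-fibreSum {m} {n} {k} φ α h = begin
    sum (λ x → ι (fibreSum φ α x) * h x)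
      ≈⟨ sum-cong-≋ {k} (λ x → trans (*-congʳ (trans (ι-sum (λ i → ℤsum λ j → δ (φ i j) x ℤ.* α i j))
           (sum-cong-≋ {m} λ i → ι-sum (λ j → δ (φ i j) x ℤ.* α i j))))
           (trans (*-distribʳ-sum {m} (h x) (λ i → sum λ j → ι (δ (φ i j) x ℤ.* α i j)))
             (sum-cong-≋ {m} λ i → *-distribʳ-sum {n} (h x) (λ j → ι (δ (φ i j) x ℤ.* α i j))))) ⟩
    sum (λ x → sum λ i → sum λ j → ι (δ (φ i j) x ℤ.* α i j) * h x)
      ≈⟨ ∑-comm {k} {m} (λ x i → sum λ j → ι (δ (φ i j) x ℤ.* α i j) * h x) ⟩
    sum (λ i → sum λ x → sum λ j → ι (δ (φ i j) x ℤ.* α i j) * h x)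
      ≈⟨ sum-cong-≋ {m} (λ i → ∑-comm {k} {n} (λ x j → ι (δ (φ i j) x ℤ.* α i j) * h x)) ⟩
    sum (λ i → sum λ j → sum λ x → ι (δ (φ i j) x ℤ.* α i j) * h x)
      ≈⟨ sum-cong-≋ {m} (λ i → sum-cong-≋ {n} λ j → trans
           (sum-cong-≋ {k} λ x → trans (*-congʳ (trans (*-homo _ _)
              (*-congʳ (reflexive (≡.cong ι (δ-sym (φ i j) x)))))) (*-assoc (ι (δ x (φ i j))) (ι (α i j)) (h x)))
           (sum-δ (φ i j) (λ x → ι (α i j) * h x))) ⟩
    sum (λ i → sum λ j → ι (α i j) * h (φ i j)) ∎

  -- Characters of a cyclic group and elements of its integral group ring.

  module RootOfUnity (n : ℕ) .{{_ : NonZero n}} (ζ : Carrier) (ζⁿ≈1 : ζ ^ n ≈ 1#) where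

    private
      ζ^n*k≈1 : ∀ k → ζ ^ (n ℕ.* k) ≈ 1#
      ζ^n*k≈1 k = trans (sym (^-assocʳ ζ n k)) (trans (^-congˡ k ζⁿ≈1) (1^≈1 k))
        where
        1^≈1 : ∀ k → 1# ^ k ≈ 1#
        1^≈1 zero    = refl
        1^≈1 (suc k) = trans (*-identityˡ _) (1^≈1 k)

    ^-% : ∀ k → ζ ^ (k % n) ≈ ζ ^ k
    ^-% k = begin
      ζ ^ (k % n)                           ≈⟨ *-identityʳ _ ⟨
      ζ ^ (k % n) * 1#                      ≈⟨ *-congˡ (ζ^n*k≈1 (k / n)) ⟨
      ζ ^ (k % n) * ζ ^ (n ℕ.* (k / n))     ≈⟨ ^-homo-* ζ (k % n) _ ⟨
      ζ ^ (k % n ℕ.+ n ℕ.* (k / n))         ≈⟨ ^-congʳ ζ (≡.trans (≡.cong (k % n ℕ.+_) (ℕ.*-comm n (k / n)))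
                                                            (≡.sym (m≡m%n+[m/n]*n k n))) ⟩
      ζ ^ k                                 ∎

    ^-*% : ∀ u k → ζ ^ (u ℕ.* (k % n)) ≈ ζ ^ (u ℕ.* k)
    ^-*% u k = begin
      ζ ^ (u ℕ.* (k % n))            ≈⟨ ^-% _ ⟨
      ζ ^ (u ℕ.* (k % n) % n)        ≈⟨ ^-congʳ ζ (≡.trans (%-distribˡ-* u (k % n) n)
                                          (≡.trans (≡.cong (λ r → (u % n ℕ.* r) % n) (m%n%n≡m%n k n)) (≡.sym (%-distribˡ-* u k n)))) ⟩
      ζ ^ (u ℕ.* k % n)              ≈⟨ ^-% _ ⟩
      ζ ^ (u ℕ.* k)                  ∎

    ω : Fin n → Fin n → Carrier
    ω u i = ζ ^ (toℕ u ℕ.* toℕ i)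

    ω-mod : ∀ u k → ω u (k mod n) ≈ ζ ^ (toℕ u ℕ.* k)
    ω-mod u k = trans (^-congʳ ζ (≡.cong (toℕ u ℕ.*_) (Fin.toℕ-fromℕ< (m%n<n k n)))) (^-*% (toℕ u) k)

    ω-modˡ : ∀ k i → ω (k mod n) i ≈ ζ ^ (k ℕ.* toℕ i)
    ω-modˡ k i = trans (^-congʳ ζ (ℕ.*-comm (toℕ (k mod n)) (toℕ i)))
      (trans (ω-mod i k) (^-congʳ ζ (ℕ.*-comm (toℕ i) k)))

    open Group (cyclicGroup n) using () renaming (_∙_ to _⊕_)

    ω-⊕ : ∀ u i j → ω u (i ⊕ j) ≈ ω u i * ω u j
    ω-⊕ u i j = begin
      ω u (i ⊕ j)                                   ≈⟨ ω-mod u (toℕ i ℕ.+ toℕ j) ⟩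
      ζ ^ (toℕ u ℕ.* (toℕ i ℕ.+ toℕ j))             ≈⟨ ^-congʳ ζ (ℕ.*-distribˡ-+ (toℕ u) (toℕ i) (toℕ j)) ⟩
      ζ ^ (toℕ u ℕ.* toℕ i ℕ.+ toℕ u ℕ.* toℕ j)     ≈⟨ ^-homo-* ζ (toℕ u ℕ.* toℕ i) _ ⟩
      ω u i * ω u j                                 ∎

    ω-^n : ∀ u i → ω u i ^ n ≈ 1#
    ω-^n u i = trans (^-assocʳ ζ (toℕ u ℕ.* toℕ i) n)
      (trans (^-congʳ ζ (ℕ.*-comm (toℕ u ℕ.* toℕ i) n)) (ζ^n*k≈1 (toℕ u ℕ.* toℕ i)))

    -- An element of ℤ[Cₙ] given by its values at the characters `ω v`, so that multiplication in
    -- the group ring becomes pointwise. The integers `r j` are its coefficients.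
    IsTransform : (Fin n → Carrier) → Set ℓ
    IsTransform f = ∃ λ (r : Fin n → ℤ) → ∀ v → f v ≈ sum λ j → ι (r j) * ω v j

    resp-isTransform : ∀ {f g} → (∀ v → f v ≈ g v) → IsTransform f → IsTransform g
    resp-isTransform f≈g (r , f≈) = r , λ v → trans (sym (f≈g v)) (f≈ v)

    +-isTransform : ∀ {f g} → IsTransform f → IsTransform g → IsTransform (λ v → f v + g v)
    +-isTransform {f} {g} (r , f≈) (s , g≈) = (λ j → r j ℤ.+ s j) , λ v → begin
      f v + g v
        ≈⟨ +-cong (f≈ v) (g≈ v) ⟩
      sum (λ j → ι (r j) * ω v j) + sum (λ j → ι (s j) * ω v j)
        ≈⟨ ∑-distrib-+ {n} (λ j → ι (r j) * ω v j) (λ j → ι (s j) * ω v j) ⟨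
      sum (λ j → ι (r j) * ω v j + ι (s j) * ω v j)
        ≈⟨ sum-cong-≋ {n} (λ j → trans (sym (distribʳ (ω v j) (ι (r j)) (ι (s j)))) (*-congʳ (sym (+-homo (r j) (s j))))) ⟩
      sum (λ j → ι (r j ℤ.+ s j) * ω v j) ∎

    -- The coefficients of a product are the convolution of the coefficients, obtained as a
    -- pushforward along addition in Cₙ.
    *-isTransform : ∀ {f g} → IsTransform f → IsTransform g → IsTransform (λ v → f v * g v)
    *-isTransform {f} {g} (r , f≈) (s , g≈) = fibreSum _⊕_ (λ i j → r i ℤ.* s j) , λ v → begin
      f v * g v
        ≈⟨ *-cong (f≈ v) (g≈ v) ⟩
      sum (λ i → ι (r i) * ω v i) * sum (λ j → ι (s j) * ω v j)
        ≈⟨ *-distribʳ-sum {n} _ (λ i → ι (r i) * ω v i) ⟩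
      sum (λ i → ι (r i) * ω v i * sum (λ j → ι (s j) * ω v j))
        ≈⟨ sum-cong-≋ {n} (λ i → trans (*-distribˡ-sum {n} (ι (r i) * ω v i) (λ j → ι (s j) * ω v j))
             (sum-cong-≋ {n} λ j → trans
               (solve 4 (λ a b c d → a :* b :* (c :* d) := a :* c :* (b :* d)) refl
                 (ι (r i)) (ω v i) (ι (s j)) (ω v j))
               (*-cong (sym (*-homo (r i) (s j))) (sym (ω-⊕ v i j))))) ⟩
      sum (λ i → sum λ j → ι (r i ℤ.* s j) * ω v (i ⊕ j))
        ≈⟨ sum-fibreSum _⊕_ (λ i j → r i ℤ.* s j) (ω v) ⟨
      sum (λ x → ι (fibreSum _⊕_ (λ i j → r i ℤ.* s j) x) * ω v x) ∎

    ω-isTransform : ∀ r k → IsTransform (λ v → ι r * ω v k)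
    ω-isTransform r k = (λ j → δ j k ℤ.* r) , λ v → sym (trans
      (sum-cong-≋ {n} λ j → trans (*-congʳ (*-homo (δ j k) r)) (*-assoc (ι (δ j k)) (ι r) (ω v j)))
      (sum-δ k (λ j → ι r * ω v j)))

    0-isTransform : IsTransform (λ _ → 0#)
    0-isTransform = (λ _ → + 0) , λ v → sym (trans
      (sum-cong-≋ {n} λ j → trans (*-congʳ 0#-homo) (zeroˡ (ω v j))) (sum-replicate-zero n))

    sum-isTransform : ∀ {m} {f : Fin m → Fin n → Carrier} →
                      (∀ i → IsTransform (f i)) → IsTransform (λ v → sum λ i → f i v)
    sum-isTransform {zero}  F = 0-isTransform
    sum-isTransform {suc m} F = +-isTransform (F zero) (sum-isTransform (F ∘ suc))

  -- Norms of cyclotomic elements for fifth roots of unity.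

  module FifthRoot (ζ : Carrier) (Φ≈0 : ζ ^ 0 + ζ ^ 1 + ζ ^ 2 + ζ ^ 3 + ζ ^ 4 ≈ 0#) where

    open Forms rawRing

    -- Reduces an identity modulo a relation `g ≈ 0#` to a polynomial identity with explicit
    -- cofactor `f`, which the ring solver can check.
    vanish : ∀ {p q f g} → p ≈ q + f * g → g ≈ 0# → p ≈ q
    vanish {p} {q} {f} {g} p≈ g≈0 = begin
      p           ≈⟨ p≈ ⟩
      q + f * g   ≈⟨ +-congˡ (trans (*-congˡ g≈0) (zeroʳ f)) ⟩
      q + 0#      ≈⟨ +-identityʳ q ⟩
      q           ∎

    ζ⁵≈1 : ζ ^ 5 ≈ 1#
    ζ⁵≈1 = vanish (solve 1 (λ z → z :^ 5 := z :^ 0 :+ (z :- con (+ 1)) :*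
                     (z :^ 0 :+ z :^ 1 :+ z :^ 2 :+ z :^ 3 :+ z :^ 4)) refl ζ) Φ≈0

    ζ⁵-1≈0 : ζ ^ 5 - ζ ^ 0 ≈ 0#
    ζ⁵-1≈0 = trans (+-congʳ ζ⁵≈1) (-‿inverseʳ 1#)

    open RootOfUnity 5 ζ ζ⁵≈1 public

    sum≈σ : ∀ x → sum x ≈ σ x
    sum≈σ x = trans (+-congˡ (+-congˡ (+-congˡ (+-congˡ (+-identityʳ _)))))
      (solve 5 (λ a b c d e → a :+ (b :+ (c :+ (d :+ e))) := a :+ b :+ c :+ d :+ e) refl _ _ _ _ _)

    transform : (Fin 5 → Carrier) → Fin 5 → Carrier
    transform x u = sum λ i → x i * ω u i

    -- Exponents are reduced modulo 5, so each conjugate becomes a polynomial of degree at most 4 in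
    -- `ζ`.
    transform-expand : ∀ x u → transform x u ≈
      x 0F * ζ ^ (toℕ u ℕ.* 0 % 5) + x 1F * ζ ^ (toℕ u ℕ.* 1 % 5) + x 2F * ζ ^ (toℕ u ℕ.* 2 % 5)
        + x 3F * ζ ^ (toℕ u ℕ.* 3 % 5) + x 4F * ζ ^ (toℕ u ℕ.* 4 % 5)
    transform-expand x u = trans
      (sum-cong-≋ {5} λ i → *-congˡ {x i} (sym (^-% (toℕ u ℕ.* toℕ i))))
      (sum≈σ λ i → x i * ζ ^ (toℕ u ℕ.* toℕ i % 5))

    transform-0F : ∀ x → transform x 0F ≈ σ x
    transform-0F x = trans (transform-expand x 0F)
      (+-cong (+-cong (+-cong (+-cong (*-identityʳ _) (*-identityʳ _)) (*-identityʳ _)) (*-identityʳ _)) (*-identityʳ _))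

    private
      η η′ : Carrier
      η  = ζ ^ 1 + ζ ^ 4
      η′ = ζ ^ 2 + ζ ^ 3

      τ : (Fin 5 → Carrier) → Carrier
      τ x = x 0F * x 0F + x 1F * x 1F + x 2F * x 2F + x 3F * x 3F + x 4F * x 4F

      conjugates₁₄ : ∀ x → transform x 1F * transform x 4F ≈ τ x + β x * η + γ x * η′
      conjugates₁₄ x = trans (*-cong (transform-expand x 1F) (transform-expand x 4F)) $ vanish
        (solve 6 (λ x0 x1 x2 x3 x4 z →
            (x0 :* z :^ 0 :+ x1 :* z :^ 1 :+ x2 :* z :^ 2 :+ x3 :* z :^ 3 :+ x4 :* z :^ 4) :*
            (x0 :* z :^ 0 :+ x1 :* z :^ 4 :+ x2 :* z :^ 3 :+ x3 :* z :^ 2 :+ x4 :* z :^ 1)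
            := (x0 :* x0 :+ x1 :* x1 :+ x2 :* x2 :+ x3 :* x3 :+ x4 :* x4)
               :+ (x0 :* x1 :+ x1 :* x2 :+ x2 :* x3 :+ x3 :* x4 :+ x4 :* x0) :* (z :^ 1 :+ z :^ 4)
               :+ (x0 :* x2 :+ x1 :* x3 :+ x2 :* x4 :+ x3 :* x0 :+ x4 :* x1) :* (z :^ 2 :+ z :^ 3)
               -- The cofactor collects the products whose exponent reaches 5, by z⁵⁺ᵏ = zᵏ + zᵏ(z⁵
               -- - 1).
               :+ (x1 :* x1 :* z :^ 0 :+ x2 :* x1 :* z :^ 1 :+ x2 :* x2 :* z :^ 0 :+ x3 :* x1 :* z :^ 2 :+ x3 :* x2 :* z :^ 1
                   :+ x3 :* x3 :* z :^ 0 :+ x4 :* x1 :* z :^ 3 :+ x4 :* x2 :* z :^ 2 :+ x4 :* x3 :* z :^ 1 :+ x4 :* x4 :* z :^ 0) :* (z :^ 5 :- z :^ 0))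
          refl (x 0F) (x 1F) (x 2F) (x 3F) (x 4F) ζ) ζ⁵-1≈0

      conjugates₂₃ : ∀ x → transform x 2F * transform x 3F ≈ τ x + β x * η′ + γ x * η
      conjugates₂₃ x = trans (*-cong (transform-expand x 2F) (transform-expand x 3F)) $ vanish
        (solve 6 (λ x0 x1 x2 x3 x4 z →
            (x0 :* z :^ 0 :+ x1 :* z :^ 2 :+ x2 :* z :^ 4 :+ x3 :* z :^ 1 :+ x4 :* z :^ 3) :*
            (x0 :* z :^ 0 :+ x1 :* z :^ 3 :+ x2 :* z :^ 1 :+ x3 :* z :^ 4 :+ x4 :* z :^ 2)
            := (x0 :* x0 :+ x1 :* x1 :+ x2 :* x2 :+ x3 :* x3 :+ x4 :* x4)
               :+ (x0 :* x1 :+ x1 :* x2 :+ x2 :* x3 :+ x3 :* x4 :+ x4 :* x0) :* (z :^ 2 :+ z :^ 3)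
               :+ (x0 :* x2 :+ x1 :* x3 :+ x2 :* x4 :+ x3 :* x0 :+ x4 :* x1) :* (z :^ 1 :+ z :^ 4)
               :+ (x1 :* x1 :* z :^ 0 :+ x1 :* x3 :* z :^ 1 :+ x2 :* x1 :* z :^ 2 :+ x2 :* x2 :* z :^ 0 :+ x2 :* x3 :* z :^ 3
                   :+ x2 :* x4 :* z :^ 1 :+ x3 :* x3 :* z :^ 0 :+ x4 :* x1 :* z :^ 1 :+ x4 :* x3 :* z :^ 2 :+ x4 :* x4 :* z :^ 0) :* (z :^ 5 :- z :^ 0))
          refl (x 0F) (x 1F) (x 2F) (x 3F) (x 4F) ζ) ζ⁵-1≈0

      η+η′ : η + η′ + ι (+ 1) ≈ 0#
      η+η′ = trans (solve 1 (λ z → (z :^ 1 :+ z :^ 4) :+ (z :^ 2 :+ z :^ 3) :+ con (+ 1)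
                               := z :^ 0 :+ z :^ 1 :+ z :^ 2 :+ z :^ 3 :+ z :^ 4) refl ζ) Φ≈0

      ηη′ : η * η′ + ι (+ 1) ≈ 0#
      ηη′ = vanish (trans (solve 1 (λ z → (z :^ 1 :+ z :^ 4) :* (z :^ 2 :+ z :^ 3) :+ con (+ 1)
                               := con (+ 0) :+ (z :^ 3 :+ con (+ 1) :- z) :* (z :^ 0 :+ z :^ 1 :+ z :^ 2 :+ z :^ 3 :+ z :^ 4)) refl ζ)
                             (+-congʳ 0#-homo)) Φ≈0

    ν : (Fin 5 → Carrier) → Carrier
    ν x = σ x * σ x * σ x * σ x + ι (+ 5) * ρ x

    -- The sum of squares is σ² − 2(β + γ), and the two products of conjugate
    -- factors are conjugate over ℤ[η], where η + η′ = ηη′ = −1.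
    transform-norm : ∀ x → product (λ k → transform x (suc k)) ≈ ν x
    transform-norm x = begin
      t 1F * (t 2F * (t 3F * (t 4F * 1#)))
        ≈⟨ *-congˡ (*-congˡ (*-congˡ (*-identityʳ _))) ⟩
      t 1F * (t 2F * (t 3F * t 4F))
        ≈⟨ solve 4 (λ a b c d → a :* (b :* (c :* d)) := (a :* d) :* (b :* c)) refl _ _ _ _ ⟩
      (t 1F * t 4F) * (t 2F * t 3F)
        ≈⟨ *-cong (conjugates₁₄ x) (conjugates₂₃ x) ⟩
      (τ x + β x * η + γ x * η′) * (τ x + β x * η′ + γ x * η)
        ≈⟨ vanish (vanish (solve 5 (λ a b c s t →
              (a :+ b :* s :+ c :* t) :* (a :+ b :* t :+ c :* s)
              := a :* a :- a :* b :- a :* c :- b :* b :- c :* c :+ con (+ 3) :* b :* c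
                 :+ (b :* b :+ c :* c :- con (+ 2) :* b :* c) :* (s :* t :+ con (+ 1))
                 :+ (a :* (b :+ c) :+ b :* c :* (s :+ t :- con (+ 1))) :* (s :+ t :+ con (+ 1)))
              refl (τ x) (β x) (γ x) η η′) η+η′) ηη′ ⟩
      τ x * τ x - τ x * β x - τ x * γ x - β x * β x - γ x * γ x + ι (+ 3) * β x * γ x
        ≈⟨ solve 5 (λ x0 x1 x2 x3 x4 →
             let s = x0 :+ x1 :+ x2 :+ x3 :+ x4
                 b = x0 :* x1 :+ x1 :* x2 :+ x2 :* x3 :+ x3 :* x4 :+ x4 :* x0
                 c = x0 :* x2 :+ x1 :* x3 :+ x2 :* x4 :+ x3 :* x0 :+ x4 :* x1
                 a = x0 :* x0 :+ x1 :* x1 :+ x2 :* x2 :+ x3 :* x3 :+ x4 :* x4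
             in a :* a :- a :* b :- a :* c :- b :* b :- c :* c :+ con (+ 3) :* b :* c
                := s :* s :* s :* s :+ con (+ 5) :* ((b :+ c) :* (b :+ c) :+ b :* c :- s :* s :* (b :+ c)))
             refl (x 0F) (x 1F) (x 2F) (x 3F) (x 4F) ⟩
      ν x ∎
      where
      t = transform x

    transform-circulant : ∀ x → product (transform x) ≈ σ x * ν x
    transform-circulant x = *-cong (transform-0F x) (transform-norm x)

    +-homo′ : ∀ {i j x y} → ι i ≈ x → ι j ≈ y → ι (i ℤ.+ j) ≈ x + y
    +-homo′ i≈x j≈y = trans (+-homo _ _) (+-cong i≈x j≈y)

    *-homo′ : ∀ {i j x y} → ι i ≈ x → ι j ≈ y → ι (i ℤ.* j) ≈ x * y
    *-homo′ i≈x j≈y = trans (*-homo _ _) (*-cong i≈x j≈y)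

    ι-σ : ∀ x → ι (Fℤ.σ x) ≈ σ (ι ∘ x)
    ι-σ x = +-homo′ (+-homo′ (+-homo′ (+-homo′ refl refl) refl) refl) refl

    ι-ν : ∀ x → ι (νℤ x) ≈ ν (ι ∘ x)
    ι-ν x = +-homo′ (*-homo′ (*-homo′ (*-homo′ (ι-σ x) (ι-σ x)) (ι-σ x)) (ι-σ x)) (*-homo′ refl ι-ρ)
      where
      ι-β : ι (Fℤ.β x) ≈ β (ι ∘ x)
      ι-β = +-homo′ (+-homo′ (+-homo′ (+-homo′ (*-homo _ _) (*-homo _ _)) (*-homo _ _)) (*-homo _ _)) (*-homo _ _)
      ι-γ : ι (Fℤ.γ x) ≈ γ (ι ∘ x)
      ι-γ = +-homo′ (+-homo′ (+-homo′ (+-homo′ (*-homo _ _) (*-homo _ _)) (*-homo _ _)) (*-homo _ _)) (*-homo _ _)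
      ι-ρ : ι (Fℤ.ρ x) ≈ ρ (ι ∘ x)
      ι-ρ = +-homo′ (+-homo′ (*-homo′ (+-homo′ ι-β ι-γ) (+-homo′ ι-β ι-γ)) (*-homo′ ι-β ι-γ))
        (trans (-‿homo _) (-‿cong (*-homo′ (*-homo′ (ι-σ x) (ι-σ x)) (+-homo′ ι-β ι-γ))))

    -- Character values on C₅ × C₅ and their Galois orbits.

    module _ (α : Fin 5 → Fin 5 → ℤ) where

      transform₂ : Fin 5 → Fin 5 → Carrier
      transform₂ u v = sum λ i → sum λ j → ι (α i j) * (ω u i * ω v j)

      -- The character with exponents (k, kl) sends (i, j) to a power of `ζ` with exponent k(i +
      -- lj), so it factors through the form `form l`.
      transform₂-form : ∀ l k → transform₂ k ((toℕ k ℕ.* toℕ l) mod 5) ≈ transform (ι ∘ fibreSum (form l) α) k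
      transform₂-form l k = trans
        (sum-cong-≋ {5} λ i → sum-cong-≋ {5} λ j → *-congˡ {ι (α i j)} (begin
          ω k i * ω ((toℕ k ℕ.* toℕ l) mod 5) j
            ≈⟨ *-congˡ (ω-modˡ (toℕ k ℕ.* toℕ l) j) ⟩
          ω k i * ζ ^ (toℕ k ℕ.* toℕ l ℕ.* toℕ j)
            ≈⟨ ^-homo-* ζ (toℕ k ℕ.* toℕ i) _ ⟨
          ζ ^ (toℕ k ℕ.* toℕ i ℕ.+ toℕ k ℕ.* toℕ l ℕ.* toℕ j)
            ≈⟨ ^-congʳ ζ (≡.trans (≡.cong (toℕ k ℕ.* toℕ i ℕ.+_) (ℕ.*-assoc (toℕ k) (toℕ l) (toℕ j)))
                 (≡.sym (ℕ.*-distribˡ-+ (toℕ k) (toℕ i) (toℕ l ℕ.* toℕ j)))) ⟩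
          ζ ^ (toℕ k ℕ.* (toℕ i ℕ.+ toℕ l ℕ.* toℕ j))
            ≈⟨ ω-mod k (toℕ i ℕ.+ toℕ l ℕ.* toℕ j) ⟨
          ω k (form l i j) ∎))
        (sym (sum-fibreSum (form l) α (ω k)))

      transform₂-form∞ : ∀ k → transform₂ 0F k ≈ transform (ι ∘ fibreSum (λ i j → j) α) k
      transform₂-form∞ k = trans
        (sum-cong-≋ {5} λ i → sum-cong-≋ {5} λ j → *-congˡ {ι (α i j)} (*-identityˡ (ω k j)))
        (sym (sum-fibreSum (λ i j → j) α (ω k)))

      transform₂-trivial : transform₂ 0F 0F ≈ ι (total α)
      transform₂-trivial = sym (trans (ι-sum (λ i → ℤsum λ j → α i j))
        (sum-cong-≋ {5} λ i → trans (ι-sum (α i))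
          (sum-cong-≋ {5} λ j → sym (trans (*-congˡ (*-identityˡ 1#)) (*-identityʳ (ι (α i j)))))))

      module CM = Algebra.Solver.CommutativeMonoid *-commutativeMonoid
      open CM using (_⊕_; _⊜_) renaming (id to 𝟙)
      -- Multiplication by the nonzero residue `suc k` permutes the residues modulo 5. This replaces
      -- the second exponent v of a character by kl, with the slope l as the new variable.
      ∏-scale : ∀ k (f : Fin 5 → Carrier) → product f ≈ product λ l → f ((toℕ (suc {4} k) ℕ.* toℕ {5} l) mod 5)
      ∏-scale 0F f = refl
      ∏-scale 1F f = CM.solve 5 (λ a b c d e → a ⊕ b ⊕ c ⊕ d ⊕ e ⊕ 𝟙 ⊜ a ⊕ c ⊕ e ⊕ b ⊕ d ⊕ 𝟙)
        refl (f 0F) (f 1F) (f 2F) (f 3F) (f 4F)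
      ∏-scale 2F f = CM.solve 5 (λ a b c d e → a ⊕ b ⊕ c ⊕ d ⊕ e ⊕ 𝟙 ⊜ a ⊕ d ⊕ b ⊕ e ⊕ c ⊕ 𝟙)
        refl (f 0F) (f 1F) (f 2F) (f 3F) (f 4F)
      ∏-scale 3F f = CM.solve 5 (λ a b c d e → a ⊕ b ⊕ c ⊕ d ⊕ e ⊕ 𝟙 ⊜ a ⊕ e ⊕ d ⊕ c ⊕ b ⊕ 𝟙)
        refl (f 0F) (f 1F) (f 2F) (f 3F) (f 4F)

      ι-product : ∀ {n} (f : Fin n → ℤ) → ι (ℤproduct f) ≈ product (ι ∘ f)
      ι-product {zero}  f = 1#-homo
      ι-product {suc n} f = *-homo′ refl (ι-product (f ∘ suc))

      nontrivialProduct : Carrier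
      nontrivialProduct = product (λ v → transform₂ 0F (suc v)) * product (λ u → product (transform₂ (suc u)))

      -- For a fixed slope l the characters (k, kl) with k = 1, ..., 4 form one orbit. Exchanging
      -- the products over k and l therefore makes each inner product a norm.
      nontrivialProduct-norms : nontrivialProduct ≈ ι (orbitNorms α)
      nontrivialProduct-norms = begin
        product (λ k → transform₂ 0F (suc k)) * product (λ k → product (transform₂ (suc k)))
          ≈⟨ *-cong
               (trans (product-cong {4} λ k → transform₂-form∞ (suc k))
                 (trans (transform-norm (ι ∘ fibreSum (λ i j → j) α)) (sym (ι-ν (fibreSum (λ i j → j) α)))))
               (product-cong {4} λ k → trans (∏-scale k (transform₂ (suc k)))
                 (product-cong {5} λ l → transform₂-form l (suc k))) ⟩
        ι (orbitNorm∞ α) * product (λ k → product λ l → transform (ι ∘ fibreSum (form l) α) (suc k))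
          ≈⟨ *-congˡ (trans (∏-comm {4} {5} (λ k l → transform (ι ∘ fibreSum (form l) α) (suc k)))
               (product-cong {5} λ l → trans (transform-norm (ι ∘ fibreSum (form l) α)) (sym (ι-ν (fibreSum (form l) α))))) ⟩
        ι (orbitNorm∞ α) * product (ι ∘ orbitNorm α)
          ≈⟨ *-homo′ refl (ι-product (orbitNorm α)) ⟨
        ι (orbitNorms α) ∎

      ∏-transform₂ : product (λ u → product (transform₂ u)) ≈ ι (total α ℤ.* orbitNorms α)
      ∏-transform₂ = trans (*-assoc _ _ _) (sym (*-homo′ (sym transform₂-trivial) (sym nontrivialProduct-norms)))

    -- The Frobenius map on ℤ[C₅] modulo 5.

    ω-0F : ∀ v → ω v 0F ≈ 1#
    ω-0F v = ^-congʳ ζ (ℕ.*-zeroʳ (toℕ v))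

    const-isTransform : ∀ r → IsTransform (λ _ → ι r)
    const-isTransform r = resp-isTransform (λ v → trans (*-congˡ (ω-0F v)) (*-identityʳ _)) (ω-isTransform r 0F)

    -‿isTransform : ∀ {f} → IsTransform f → IsTransform (λ v → - f v)
    -‿isTransform {f} F = resp-isTransform
      (λ v → solve 1 (λ x → con -1ℤ :* x := :- x) refl (f v))
      (*-isTransform (const-isTransform -1ℤ) F)

    -- The same `c` serves all five characters, so the congruence modulo 5 holds in ℤ[C₅] and not
    -- merely value by value.
    HasIntegralFifthPower : (Fin 5 → Carrier) → Set _
    HasIntegralFifthPower f = ∃ λ c → ∃ λ g → IsTransform g × (∀ v → f v ^ 5 ≈ ι c + ι (+ 5) * g v)

    -- The transform property is carried along because the mixed terms of (f + g)⁵, divided by 5,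
    -- must again lie in ℤ[C₅].
    Frobenius : (Fin 5 → Carrier) → Set _
    Frobenius f = IsTransform f × HasIntegralFifthPower f

    +-frobenius : ∀ {f g} → Frobenius f → Frobenius g → Frobenius (λ v → f v + g v)
    +-frobenius {f} {g} (F , c , f′ , F′ , f⁵) (G , d , g′ , G′ , g⁵) =
      +-isTransform F G , c ℤ.+ d , _ , +-isTransform (+-isTransform F′ G′) H , λ v → begin
        (f v + g v) ^ 5
          ≈⟨ solve 2 (λ x y → (x :+ y) :^ 5 := x :^ 5 :+ y :^ 5 :+ con (+ 5) :*
               (x :* y :* (x :* (x :* x :+ x :* y) :+ (x :+ y) :* (x :* y :+ y :* y)))) refl (f v) (g v) ⟩
        f v ^ 5 + g v ^ 5 + ι (+ 5) * h v
          ≈⟨ +-congʳ (+-cong (f⁵ v) (g⁵ v)) ⟩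
        (ι c + ι (+ 5) * f′ v) + (ι d + ι (+ 5) * g′ v) + ι (+ 5) * h v
          ≈⟨ solve 6 (λ a b p q r z → (a :+ z :* p) :+ (b :+ z :* q) :+ z :* r := (a :+ b) :+ z :* (p :+ q :+ r)) refl
               (ι c) (ι d) (f′ v) (g′ v) (h v) (ι (+ 5)) ⟩
        (ι c + ι d) + ι (+ 5) * (f′ v + g′ v + h v)
          ≈⟨ +-congʳ (+-homo c d) ⟨
        ι (c ℤ.+ d) + ι (+ 5) * (f′ v + g′ v + h v) ∎
      where
      h : Fin 5 → Carrier
      h v = f v * g v * (f v * (f v * f v + f v * g v) + (f v + g v) * (f v * g v + g v * g v))
      H : IsTransform h
      H = *-isTransform (*-isTransform F G) (+-isTransform
            (*-isTransform F (+-isTransform (*-isTransform F F) (*-isTransform F G)))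
            (*-isTransform (+-isTransform F G) (+-isTransform (*-isTransform F G) (*-isTransform G G))))

    -- The fifth power kills the group element, since C₅ has exponent 5; only r⁵ survives, without
    -- any correction term.
    ω-frobenius : ∀ r j → Frobenius (λ v → ι r * ω v j)
    ω-frobenius r j = ω-isTransform r j , r ℤ.* (r ℤ.* (r ℤ.* (r ℤ.* r))) , _ , 0-isTransform , λ v → begin
      (ι r * ω v j) ^ 5
        ≈⟨ solve 2 (λ r x → (r :* x) :^ 5 := r :* (r :* (r :* (r :* r))) :* x :^ 5) refl (ι r) (ω v j) ⟩
      ι r * (ι r * (ι r * (ι r * ι r))) * ω v j ^ 5
        ≈⟨ *-cong (sym (*-homo′ refl (*-homo′ refl (*-homo′ refl (*-homo r r))))) (ω-^n v j) ⟩
      ι (r ℤ.* (r ℤ.* (r ℤ.* (r ℤ.* r)))) * 1#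
        ≈⟨ trans (*-identityʳ _) (sym (trans (+-congˡ (zeroʳ _)) (+-identityʳ _))) ⟩
      ι (r ℤ.* (r ℤ.* (r ℤ.* (r ℤ.* r)))) + ι (+ 5) * 0# ∎

    sum-frobenius : ∀ {m} {f : Fin (suc m) → Fin 5 → Carrier} →
                    (∀ i → Frobenius (f i)) → Frobenius (λ v → sum λ i → f i v)
    sum-frobenius {zero}  {f} F = resp-frobenius (λ v → sym (+-identityʳ _)) (F zero)
      where
      resp-frobenius : ∀ {f g} → (∀ v → f v ≈ g v) → Frobenius f → Frobenius g
      resp-frobenius f≈g (F , c , f′ , F′ , f⁵) =
        resp-isTransform f≈g F , c , f′ , F′ , λ v → trans (^-congˡ 5 (sym (f≈g v))) (f⁵ v)
    sum-frobenius {suc m} F = +-frobenius (F zero) (sum-frobenius (F ∘ suc))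

    transform-shift : ∀ c r v → transform (ι ∘ shift c r) v ≈ ι c + ι (+ 5) * transform (ι ∘ r) v
    transform-shift c r v = begin
      ι (c ℤ.+ + 5 ℤ.* r 0F) * ω v 0F + sum (λ j → ι (+ 5 ℤ.* r (suc j)) * ω v (suc j))
        ≈⟨ +-cong (*-congʳ (+-homo′ refl (*-homo (+ 5) (r 0F))))
             (trans (sum-cong-≋ {4} λ j → trans (*-congʳ (*-homo (+ 5) (r (suc j)))) (*-assoc (ι (+ 5)) (ι (r (suc j))) (ω v (suc j))))
                    (sym (*-distribˡ-sum {4} (ι (+ 5)) (λ j → ι (r (suc j)) * ω v (suc j))))) ⟩
      (ι c + ι (+ 5) * ι (r 0F)) * ω v 0F + ι (+ 5) * t
        ≈⟨ solve 5 (λ c z r w s → (c :+ z :* r) :* w :+ z :* s := c :* w :+ z :* (r :* w :+ s)) refl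
             (ι c) (ι (+ 5)) (ι (r 0F)) (ω v 0F) t ⟩
      ι c * ω v 0F + ι (+ 5) * transform (ι ∘ r) v
        ≈⟨ +-congʳ (trans (*-congˡ (ω-0F v)) (*-identityʳ _)) ⟩
      ι c + ι (+ 5) * transform (ι ∘ r) v ∎
      where
      t = sum λ j → ι (r (suc j)) * ω v (suc j)

    module _ (α : Fin 5 → Fin 5 → ℤ) where

      -- For varying `v` this represents the element Σⱼ αᵢⱼyʲ of ℤ[C₅]. The five of them are the
      -- entries of a circulant over ℤ[C₅], whose determinant is the product over the characters of
      -- the first coordinate.
      row : Fin 5 → Fin 5 → Carrier
      row v i = sum λ j → ι (α i j) * ω v j

      row-isTransform : ∀ i → IsTransform (λ v → row v i)
      row-isTransform i = sum-isTransform λ j → ω-isTransform (α i j) j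

      sum-row-frobenius : Frobenius (λ v → sum (row v))
      sum-row-frobenius = sum-frobenius λ i → sum-frobenius λ j → ω-frobenius (α i j) j

      transform-row : ∀ u v → transform₂ α u v ≈ transform (row v) u
      transform-row u v = sum-cong-≋ {5} λ i → sym (trans
        (*-distribʳ-sum {5} (ω u i) (λ j → ι (α i j) * ω v j))
        (sum-cong-≋ {5} λ j → solve 3 (λ a x y → a :* y :* x := a :* (x :* y)) refl (ι (α i j)) (ω u i) (ω v j)))

      σ-row-0F : σ (row 0F) ≈ ι (total α)
      σ-row-0F = trans (sym (sum≈σ (row 0F))) (sym (trans (ι-sum (λ i → ℤsum λ j → α i j))
        (sum-cong-≋ {5} λ i → trans (ι-sum (α i)) (sum-cong-≋ {5} λ j → sym (*-identityʳ (ι (α i j)))))))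

    module _ (x : Fin 5 → Fin 5 → Carrier) (X : ∀ i → IsTransform (λ v → x v i)) where

      private
        infixl 7 _·_
        _·_ : ∀ i j → IsTransform (λ v → x v i * x v j)
        i · j = *-isTransform (X i) (X j)

        +₅-isTransform : ∀ {f₀ f₁ f₂ f₃ f₄} → IsTransform f₀ → IsTransform f₁ → IsTransform f₂ → IsTransform f₃ → IsTransform f₄ →
                         IsTransform (λ v → f₀ v + f₁ v + f₂ v + f₃ v + f₄ v)
        +₅-isTransform F₀ F₁ F₂ F₃ F₄ = +-isTransform (+-isTransform (+-isTransform (+-isTransform F₀ F₁) F₂) F₃) F₄

        σρ : ∀ {s b c} → IsTransform s → IsTransform b → IsTransform c →
             IsTransform (λ v → s v * ((b v + c v) * (b v + c v) + b v * c v + - (s v * s v * (b v + c v))))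
        σρ S′ B′ C′ = *-isTransform S′ (+-isTransform
          (+-isTransform (*-isTransform (+-isTransform B′ C′) (+-isTransform B′ C′)) (*-isTransform B′ C′))
          (-‿isTransform (*-isTransform (*-isTransform S′ S′) (+-isTransform B′ C′))))

      -- Five times this expression is the difference between the circulant determinant σν and σ⁵,
      -- so it has to be an element of ℤ[C₅].
      σρ-isTransform : IsTransform (λ v → σ (x v) * ρ (x v))
      σρ-isTransform = σρ (+₅-isTransform (X 0F) (X 1F) (X 2F) (X 3F) (X 4F))
        (+₅-isTransform (0F · 1F) (1F · 2F) (2F · 3F) (3F · 4F) (4F · 0F))
        (+₅-isTransform (0F · 2F) (1F · 3F) (2F · 4F) (3F · 0F) (4F · 1F))

    -- The product over u is a polynomial with integer coefficients in the transforms
    -- of the rows, congruent modulo 5 to the fifth power of their sum, and the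
    -- Frobenius map sends transforms to constants modulo 5.
    ∏-transform₂-shift : ∀ α → ∃ λ k → ∃ λ r → ∃ λ q →
      product (λ u → product (transform₂ α u)) ≈ ι (Fℤ.σ (shift k r) ℤ.* νℤ (shift k r)) ×
      ι (Fℤ.σ (shift k r)) ≈ ι (total α ℤ.* total α ℤ.* total α ℤ.* total α ℤ.* total α ℤ.+ + 5 ℤ.* q)
    ∏-transform₂-shift α = go (proj₂ (sum-row-frobenius α)) (σρ-isTransform (row α) (row-isTransform α))
      where
      x : Fin 5 → Fin 5 → Carrier
      x = row α

      e : Fin 5 → Carrier
      e v = σ (x v) * ρ (x v)

      circulant-row : ∀ v → σ (x v) * ν (x v) ≈ σ (x v) ^ 5 + ι (+ 5) * e v
      circulant-row v = solve 3 (λ s z r → s :* (s :* s :* s :* s :+ z :* r) := s :^ 5 :+ z :* (s :* r)) refl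
        (σ (x v)) (ι (+ 5)) (ρ (x v))

      go : HasIntegralFifthPower (λ v → sum (x v)) → IsTransform e → _
      go (k , g , G , x⁵) E@(e′ , e≈) with r , r≈ ← +-isTransform G E = k , r , Fℤ.σ e′ , product≈ , σ≈
        where
        circulant-row-shift : ∀ v → σ (x v) * ν (x v) ≈ transform (ι ∘ shift k r) v
        circulant-row-shift v = begin
          σ (x v) * ν (x v)
            ≈⟨ circulant-row v ⟩
          σ (x v) ^ 5 + ι (+ 5) * e v
            ≈⟨ +-congʳ (trans (^-congˡ 5 (sym (sum≈σ (x v)))) (x⁵ v)) ⟩
          ι k + ι (+ 5) * g v + ι (+ 5) * e v
            ≈⟨ solve 4 (λ k z g e → k :+ z :* g :+ z :* e := k :+ z :* (g :+ e)) refl (ι k) (ι (+ 5)) (g v) (e v) ⟩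
          ι k + ι (+ 5) * (g v + e v)
            ≈⟨ +-congˡ (*-congˡ (r≈ v)) ⟩
          ι k + ι (+ 5) * transform (ι ∘ r) v
            ≈⟨ transform-shift k r v ⟨
          transform (ι ∘ shift k r) v ∎

        product≈ : product (λ u → product (transform₂ α u)) ≈ ι (Fℤ.σ (shift k r) ℤ.* νℤ (shift k r))
        product≈ = begin
          product (λ u → product (transform₂ α u))
            ≈⟨ ∏-comm {5} {5} (transform₂ α) ⟩
          product (λ v → product λ u → transform₂ α u v)
            ≈⟨ product-cong {5} (λ v → trans (product-cong {5} λ u → transform-row α u v)
                 (trans (transform-circulant (x v)) (circulant-row-shift v))) ⟩
          product (transform (ι ∘ shift k r))
            ≈⟨ transform-circulant (ι ∘ shift k r) ⟩
          σ (ι ∘ shift k r) * ν (ι ∘ shift k r)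
            ≈⟨ *-homo′ (ι-σ (shift k r)) (ι-ν (shift k r)) ⟨
          ι (Fℤ.σ (shift k r) ℤ.* νℤ (shift k r)) ∎

        -- The coefficient sum is the value at the trivial character `0F`, where the entries of the
        -- circulant add up to `total α`.
        σ≈ : ι (Fℤ.σ (shift k r)) ≈ ι (total α ℤ.* total α ℤ.* total α ℤ.* total α ℤ.* total α ℤ.+ + 5 ℤ.* Fℤ.σ e′)
        σ≈ = begin
          ι (Fℤ.σ (shift k r))
            ≈⟨ ι-σ (shift k r) ⟩
          σ (ι ∘ shift k r)
            ≈⟨ transform-0F (ι ∘ shift k r) ⟨
          transform (ι ∘ shift k r) 0F
            ≈⟨ circulant-row-shift 0F ⟨
          σ (x 0F) * ν (x 0F)
            ≈⟨ circulant-row 0F ⟩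
          σ (x 0F) ^ 5 + ι (+ 5) * e 0F
            ≈⟨ +-cong (trans (^-congˡ 5 (σ-row-0F α)) (solve 1 (λ s → s :^ 5 := s :* s :* s :* s :* s) refl (ι (total α))))
                 (*-congˡ (trans (e≈ 0F) (trans (transform-0F (ι ∘ e′)) (sym (ι-σ e′))))) ⟩
          ι (total α) * ι (total α) * ι (total α) * ι (total α) * ι (total α) + ι (+ 5) * ι (Fℤ.σ e′)
            ≈⟨ +-homo′ (*-homo′ (*-homo′ (*-homo′ (*-homo _ _) refl) refl) refl) (*-homo _ _) ⟨
          ι (total α ℤ.* total α ℤ.* total α ℤ.* total α ℤ.* total α ℤ.+ + 5 ℤ.* Fℤ.σ e′) ∎

    -- The group determinant of C₅ × C₅ as a product of character values.

    private
      module G₅ = FiniteGroup G₅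

    -- The dual group is identified with C₅ × C₅ itself, so the enumeration of the group also
    -- indexes its characters.
    character : Fin 25 → G₅.Carrier → Carrier
    character c (i , j) = ω (proj₁ (G₅.element c)) i * ω (proj₂ (G₅.element c)) j

    character-∙ : ∀ c g h → character c (g G₅.∙ h) ≈ character c g * character c h
    character-∙ c (i , j) (i′ , j′) = trans (*-cong (ω-⊕ u i i′) (ω-⊕ v j j′))
      (interchange (ω u i) (ω u i′) (ω v j) (ω v j′))
      where
      open Algebra.Properties.CommutativeSemigroup *-commutativeSemigroup using (interchange)
      u = proj₁ (G₅.element c)
      v = proj₂ (G₅.element c)

    sum-ω-0F : sum (λ u → ω u 0F) ≈ ι (+ 5)
    sum-ω-0F = trans (sum-cong-≋ {5} ω-0F) (trans (sum≈σ λ _ → 1#)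
      (solve 1 (λ z → z :^ 0 :+ z :^ 0 :+ z :^ 0 :+ z :^ 0 :+ z :^ 0 := con (+ 5)) refl ζ))

    sum-ω-suc : ∀ i → sum (λ u → ω u (suc i)) ≈ 0#
    sum-ω-suc i = trans (sum-cong-≋ {5} λ u → sym (^-% (toℕ u ℕ.* suc (toℕ i))))
      (trans (sum≈σ λ u → ζ ^ (toℕ u ℕ.* suc (toℕ i) % 5)) (trans (reorder i) Φ≈0))
      where
      reorder : ∀ i → σ (λ u → ζ ^ (toℕ u ℕ.* suc (toℕ {4} i) % 5)) ≈ ζ ^ 0 + ζ ^ 1 + ζ ^ 2 + ζ ^ 3 + ζ ^ 4
      reorder 0F = refl
      reorder 1F = solve 1 (λ z → z :^ 0 :+ z :^ 2 :+ z :^ 4 :+ z :^ 1 :+ z :^ 3 := z :^ 0 :+ z :^ 1 :+ z :^ 2 :+ z :^ 3 :+ z :^ 4) refl ζ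
      reorder 2F = solve 1 (λ z → z :^ 0 :+ z :^ 3 :+ z :^ 1 :+ z :^ 4 :+ z :^ 2 := z :^ 0 :+ z :^ 1 :+ z :^ 2 :+ z :^ 3 :+ z :^ 4) refl ζ
      reorder 3F = solve 1 (λ z → z :^ 0 :+ z :^ 4 :+ z :^ 3 :+ z :^ 2 :+ z :^ 1 := z :^ 0 :+ z :^ 1 :+ z :^ 2 :+ z :^ 3 :+ z :^ 4) refl ζ

    ω-comm : ∀ u i → ω u i ≈ ω i u
    ω-comm u i = ^-congʳ ζ (ℕ.*-comm (toℕ u) (toℕ i))

    sum-character : ∀ i j → sum (λ c → character c (i , j)) ≈ sum (λ u → ω u i) * sum (λ v → ω v j)
    sum-character i j = begin
      sum (λ c → character c (i , j))
        ≈⟨ sum-combine +-commutativeMonoid 5 5 (λ c → character c (i , j)) ⟩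
      sum {5} (λ u → sum {5} λ v → character (combine u v) (i , j))
        ≈⟨ sum-cong-≋ {5} (λ u → sum-cong-≋ {5} λ v →
             reflexive (≡.cong (λ (u , v) → ω u i * ω v j) (Fin.remQuot-combine u v))) ⟩
      sum (λ u → sum λ v → ω u i * ω v j)
        ≈⟨ sum-cong-≋ {5} (λ u → *-distribˡ-sum {5} (ω u i) (λ v → ω v j)) ⟨
      sum (λ u → ω u i * sum λ v → ω v j)
        ≈⟨ *-distribʳ-sum {5} (sum λ v → ω v j) (λ u → ω u i) ⟨
      sum (λ u → ω u i) * sum (λ v → ω v j) ∎

    sum-character-ε : sum (λ c → character c G₅.ε) ≈ ι (+ 25)
    sum-character-ε = trans (sum-character 0F 0F) (trans (*-cong sum-ω-0F sum-ω-0F) (sym (*-homo (+ 5) (+ 5))))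

    character-orthogonality : ∀ g → ¬ g G₅.≈ G₅.ε → sum (λ c → character c g) ≈ 0#
    character-orthogonality (0F    , 0F)    g≉ε = contradiction (≡.refl , ≡.refl) g≉ε
    character-orthogonality (0F    , suc j) g≉ε = trans (sum-character 0F (suc j)) (trans (*-congˡ (sum-ω-suc j)) (zeroʳ _))
    character-orthogonality (suc i , j)     g≉ε = trans (sum-character (suc i) j) (trans (*-congʳ (sum-ω-suc i)) (zeroˡ _))

    module _ (a : Family G₅) where

      values : Fin 5 → Fin 5 → ℤ
      values i j = Func.to a (i , j)

      character-value : ∀ c → sum (λ j → ι (Func.to a (G₅.element j)) * character c (G₅.element j)) ≈
                        uncurry (transform₂ values) (G₅.element c)
      character-value c = trans
        (sum-combine +-commutativeMonoid 5 5 (λ k → F (G₅.element k)))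
        (sum-cong-≋ {5} λ i → sum-cong-≋ {5} λ j → reflexive (≡.cong F (Fin.remQuot-combine i j)))
        where
        F : Fin 5 × Fin 5 → Carrier
        F g = ι (Func.to a g) * character c g

      -- The factor `N` has to stay on both sides, because 25 may be a zero divisor in a general
      -- ring `R`.
      Θ-G₅ : let N = product {25} λ _ → ι (+ 25) in
             ι (Θ G₅ a) * N ≈ product (λ u → product (transform₂ values u)) * N
      Θ-G₅ = trans
        (Dedekind.Θ-product G₅ a character (λ c → λ where (≡.refl , ≡.refl) → refl) character-∙
          (ι (+ 25)) sum-character-ε character-orthogonality)
        (*-congʳ (trans (product-cong {25} character-value)
          (trans (sum-combine *-commutativeMonoid 5 5 (λ k → F (G₅.element k)))
            (product-cong {5} λ u → product-cong {5} λ v → reflexive (≡.cong F (Fin.remQuot-combine u v))))))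
        where
        F : Fin 5 × Fin 5 → Carrier
        F = uncurry (transform₂ values)

    module _ (α : Fin 5 → Fin 5 → ℤ) (k : ℤ) where

      translate : Fin 5 → Fin 5 → ℤ
      translate i j = α i j ℤ.+ k

      transform₂-translate : ∀ u v → transform₂ translate u v ≈
        transform₂ α u v + ι k * (sum (λ i → ω u i) * sum (λ j → ω v j))
      transform₂-translate u v = begin
        sum {5} (λ i → sum {5} λ j → ι (α i j ℤ.+ k) * (ω u i * ω v j))
          ≈⟨ sum-cong-≋ {5} (λ i → trans
               (sum-cong-≋ {5} λ j → trans (*-congʳ (+-homo (α i j) k))
                 (solve 4 (λ a k x y → (a :+ k) :* (x :* y) := a :* (x :* y) :+ k :* x :* y) refl (ι (α i j)) (ι k) (ω u i) (ω v j)))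
               (trans (∑-distrib-+ {5} (λ j → ι (α i j) * (ω u i * ω v j)) (λ j → ι k * ω u i * ω v j))
                 (+-congˡ (sym (*-distribˡ-sum {5} (ι k * ω u i) (λ j → ω v j)))))) ⟩
        sum {5} (λ i → sum {5} (λ j → ι (α i j) * (ω u i * ω v j)) + ι k * ω u i * y)
          ≈⟨ ∑-distrib-+ {5} (λ i → sum {5} (λ j → ι (α i j) * (ω u i * ω v j))) (λ i → ι k * ω u i * y) ⟩
        transform₂ α u v + sum {5} (λ i → ι k * ω u i * y)
          ≈⟨ +-congˡ (trans (sym (*-distribʳ-sum {5} y (λ i → ι k * ω u i)))
               (trans (*-congʳ (sym (*-distribˡ-sum {5} (ι k) (λ i → ω u i)))) (*-assoc (ι k) (sum {5} λ i → ω u i) y))) ⟩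
        transform₂ α u v + ι k * (sum (λ i → ω u i) * y) ∎
        where
        y = sum {5} λ j → ω v j

      transform₂-translate-0 : ∀ u v {x} → sum (λ i → ω u i) * sum (λ j → ω v j) ≈ 0# →
                               transform₂ α u v ≈ x → transform₂ translate u v ≈ x
      transform₂-translate-0 u v {x} 0≈ ≈x = trans (transform₂-translate u v)
        (trans (+-cong ≈x (trans (*-congˡ 0≈) (zeroʳ (ι k)))) (+-identityʳ x))

      ∏-transform₂-translate : product (λ u → product (transform₂ translate u)) ≈
                               ι ((total α ℤ.+ + 25 ℤ.* k) ℤ.* orbitNorms α)
      ∏-transform₂-translate = trans
        (*-cong
          (*-cong trivial (product-cong {4} λ v → transform₂-translate-0 0F (suc v) (trans (*-congˡ (sum-ω-suc′ v)) (zeroʳ _)) refl))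
          (product-cong {4} λ u → product-cong {5} λ v → transform₂-translate-0 (suc u) v (trans (*-congʳ (sum-ω-suc′ u)) (zeroˡ _)) refl))
        (trans (*-assoc _ _ _) (sym (*-homo′ refl (sym (nontrivialProduct-norms α)))))
        where
        sum-ω-suc′ : ∀ u → sum (λ i → ω (suc u) i) ≈ 0#
        sum-ω-suc′ u = trans (sum-cong-≋ {5} (ω-comm (suc u))) (sum-ω-suc u)
        trivial : transform₂ translate 0F 0F ≈ ι (total α ℤ.+ + 25 ℤ.* k)
        trivial = begin
          transform₂ translate 0F 0F
            ≈⟨ transform₂-translate 0F 0F ⟩
          transform₂ α 0F 0F + ι k * (sum (λ i → ω 0F i) * sum (λ j → ω 0F j))
            ≈⟨ +-cong (transform₂-trivial α) (*-congˡ (*-cong ω-0F-sum ω-0F-sum)) ⟩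
          ι (total α) + ι k * (ι (+ 5) * ι (+ 5))
            ≈⟨ +-homo′ refl (trans (*-homo (+ 25) k) (trans (*-comm _ _) (*-congˡ (*-homo (+ 5) (+ 5))))) ⟨
          ι (total α ℤ.+ + 25 ℤ.* k) ∎
          where
          ω-0F-sum : sum (λ i → ω 0F i) ≈ ι (+ 5)
          ω-0F-sum = trans (sum-cong-≋ {5} (ω-comm 0F)) sum-ω-0F

    -- The two hypotheses on `ι` remove the power of 25 and bring identities in the ring back to ℤ;
    -- both hold for ℤ[ζ] because it is free over ℤ with 1 in a basis.
    module Descent
      (ι-injective : ∀ {m n} → ι m ≈ ι n → m ≡ n)
      (ι-cancelʳ : ∀ n .{{_ : ℤ.NonZero n}} {x y} → x * ι n ≈ y * ι n → x ≈ y) where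

      private
        product-cancel : ∀ n {x y} → x * product {n} (λ _ → ι (+ 25)) ≈ y * product {n} (λ _ → ι (+ 25)) → x ≈ y
        product-cancel zero    x≈y = trans (sym (*-identityʳ _)) (trans x≈y (*-identityʳ _))
        product-cancel (suc n) x≈y = ι-cancelʳ (+ 25) (product-cancel n (trans (*-assoc _ _ _) (trans x≈y (sym (*-assoc _ _ _)))))

      ι-Θ : ∀ a → ι (Θ G₅ a) ≈ product λ u → product (transform₂ (values a) u)
      ι-Θ a = product-cancel 25 (Θ-G₅ a)

      Θ-norms : ∀ a → Θ G₅ a ≡ total (values a) ℤ.* orbitNorms (values a)
      Θ-norms a = ι-injective (trans (ι-Θ a) (∏-transform₂ (values a)))

      Θ-shift : ∀ a → let s = total (values a) in ∃ λ k → ∃ λ r → ∃ λ q →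
                Θ G₅ a ≡ Fℤ.σ (shift k r) ℤ.* νℤ (shift k r) ×
                Fℤ.σ (shift k r) ≡ s ℤ.* s ℤ.* s ℤ.* s ℤ.* s ℤ.+ + 5 ℤ.* q
      Θ-shift a = descend (Θ G₅ a) (total (values a)) (ι-Θ a) (∏-transform₂-shift (values a))
        where
        descend : ∀ m s {x} → ι m ≈ x →
          (∃ λ k → ∃ λ r → ∃ λ q → x ≈ ι (Fℤ.σ (shift k r) ℤ.* νℤ (shift k r)) ×
                   ι (Fℤ.σ (shift k r)) ≈ ι (s ℤ.* s ℤ.* s ℤ.* s ℤ.* s ℤ.+ + 5 ℤ.* q)) →
          ∃ λ k → ∃ λ r → ∃ λ q → m ≡ Fℤ.σ (shift k r) ℤ.* νℤ (shift k r) ×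
                   Fℤ.σ (shift k r) ≡ s ℤ.* s ℤ.* s ℤ.* s ℤ.* s ℤ.+ + 5 ℤ.* q
        descend m s m≈x (k , r , q , x≈ , σ≈) = k , r , q , ι-injective (trans m≈x x≈) , ι-injective σ≈

      family : (Fin 5 → Fin 5 → ℤ) → Family G₅
      family α = record { to = uncurry α ; cong = λ where (≡.refl , ≡.refl) → ≡.refl }

      translate∈S : ∀ α k → S G₅ ((total α ℤ.+ + 25 ℤ.* k) ℤ.* orbitNorms α)
      translate∈S α k = family (translate α k) ,
        ι-injective (sym (trans (ι-Θ (family (translate α k))) (∏-transform₂-translate α k)))

-- Divisibility by powers of 5 and congruences modulo 25 in ℤ.

module _ where
  open Data.Integer.Solver.+-*-Solver
  open Data.Integer.Base using (_+_; _*_; _-_; -_)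
  open Fℤ
  open Algebra.Properties.Semiring.Sum (CommutativeRing.semiring ℤ.+-*-commutativeRing)
    using (sum-cong-≗; ∑-distrib-+; *-distribˡ-sum; *-distribʳ-sum)
  open ≡.≡-Reasoning

  residue : ∀ n → ∃ λ (r : Fin 5) → ∃ λ q → n ≡ + toℕ r + q * + 5
  residue n = fromℕ< (ℤ.n%ℕd<d n 5) , n ℤ./ℕ 5 ,
    ≡.trans (ℤ.a≡a%ℕn+[a/ℕn]*n n 5) (≡.cong (λ r → + r + n ℤ./ℕ 5 * + 5) (≡.sym (Fin.toℕ-fromℕ< (ℤ.n%ℕd<d n 5))))

  *-mono-∣ : ∀ a b m n → a ∣ m → b ∣ n → a * b ∣ m * n
  *-mono-∣ a b _ _ (divides p ≡.refl) (divides q ≡.refl) = divides (p * q)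
    (solve 4 (λ p a q b → p :* a :* (q :* b) := p :* q :* (a :* b)) ≡.refl p a q b)

  ^∣product : ∀ {n p} (f : Fin n → ℤ) → (∀ i → p ∣ f i) → p ℤ.^ n ∣ ℤproduct f
  ^∣product {zero}  f p∣f = divides (+ 1) ≡.refl
  ^∣product {suc n} {p} f p∣f = *-mono-∣ p (p ℤ.^ n) (f zero) (ℤproduct (f ∘ suc)) (p∣f zero) (^∣product (f ∘ suc) (p∣f ∘ suc))

  ^∣product-extra : ∀ {n p} (f : Fin n → ℤ) → (∀ i → p ∣ f i) → ∀ i → p * p ∣ f i → p ℤ.^ suc n ∣ ℤproduct f
  ^∣product-extra {suc n} {p} f p∣f zero    p²∣ = ≡.subst (_∣ ℤproduct f) (ℤ.*-assoc p p (p ℤ.^ n))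
    (*-mono-∣ (p * p) (p ℤ.^ n) (f zero) (ℤproduct (f ∘ suc)) p²∣ (^∣product (f ∘ suc) (p∣f ∘ suc)))
  ^∣product-extra {suc n} {p} f p∣f (suc i) p²∣ = *-mono-∣ p (p ℤ.^ suc n) (f zero) (ℤproduct (f ∘ suc)) (p∣f zero) (^∣product-extra (f ∘ suc) (p∣f ∘ suc) i p²∣)

  infix 8 _⁵
  _⁵ : ℤ → ℤ
  n ⁵ = n * n * n * n * n

  quinticTerm : ℤ → ℤ → ℤ
  quinticTerm r p = r * r * r * r * p + + 10 * r * r * r * p * p + + 50 * r * r * p * p * p
    + + 125 * r * p * p * p * p + + 125 * p * p * p * p * p

  quintic : ∀ r p → (r + + 5 * p) ⁵ ≡ r ⁵ + + 25 * quinticTerm r p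
  quintic = solve 2 (λ r p → let s = r :+ con (+ 5) :* p in
    s :* s :* s :* s :* s
    := r :* r :* r :* r :* r :+ con (+ 25) :*
       (r :* r :* r :* r :* p :+ con (+ 10) :* r :* r :* r :* p :* p :+ con (+ 50) :* r :* r :* p :* p :* p
         :+ con (+ 125) :* r :* p :* p :* p :* p :+ con (+ 125) :* p :* p :* p :* p :* p)) ≡.refl

  5∣ν : ∀ x → + 5 ∣ σ x → + 5 ∣ νℤ x
  5∣ν x 5∣σ = ∣m∣n⇒∣m+n (∣n⇒∣m*n (σ x * σ x * σ x) 5∣σ) (∣m⇒∣m*n (ρ x) (divides (+ 1) ≡.refl))

  -- With π = 1 - ζ one has ζⁱ ≡ 1 - iπ modulo π², so Σ xᵢζⁱ ≡ `σ x` - `moment x` · π. If 5 divides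
  -- both, the element lies in (π²), an ideal of norm 25.
  moment : (Fin 5 → ℤ) → ℤ
  moment x = ℤsum λ i → x i * + toℕ i

  -- β − γ = σ·Σi²xᵢ − (Σixᵢ)² modulo 5, because (i − j)² is 1 or −1 modulo 5
  -- according to whether xᵢxⱼ occurs in β or in γ.
  25∣ν : ∀ x → + 5 ∣ σ x → + 5 ∣ moment x → + 25 ∣ νℤ x
  25∣ν x (divides s σ≡) (divides m moment≡) = divides
    (+ 25 * s * s * s * s + + 5 * d * d + β x * γ x - + 5 * s * s * (β x + γ x)) (begin
      σ x * σ x * σ x * σ x + + 5 * ρ x
        ≡⟨ solve 3 (λ s b c → s :* s :* s :* s :+ con (+ 5) :* ((b :+ c) :* (b :+ c) :+ b :* c :+ :- (s :* s :* (b :+ c)))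
             := s :* s :* s :* s :+ con (+ 5) :* ((b :- c) :* (b :- c) :+ con (+ 5) :* b :* c :- s :* s :* (b :+ c)))
             ≡.refl (σ x) (β x) (γ x) ⟩
      σ x * σ x * σ x * σ x + + 5 * ((β x - γ x) * (β x - γ x) + + 5 * β x * γ x - σ x * σ x * (β x + γ x))
        ≡⟨ ≡.cong₂ (λ s e → s * s * s * s + + 5 * (e * e + + 5 * β x * γ x - s * s * (β x + γ x))) σ≡ β-γ ⟩
      (s * + 5) * (s * + 5) * (s * + 5) * (s * + 5)
        + + 5 * ((d * + 5) * (d * + 5) + + 5 * β x * γ x - (s * + 5) * (s * + 5) * (β x + γ x))
        ≡⟨ solve 4 (λ s d b c → let s′ = s :* con (+ 5); d′ = d :* con (+ 5) in
             s′ :* s′ :* s′ :* s′ :+ con (+ 5) :* (d′ :* d′ :+ con (+ 5) :* b :* c :- s′ :* s′ :* (b :+ c))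
             := (con (+ 25) :* s :* s :* s :* s :+ con (+ 5) :* d :* d :+ b :* c :- con (+ 5) :* s :* s :* (b :+ c)) :* con (+ 25))
             ≡.refl s d (β x) (γ x) ⟩
      (+ 25 * s * s * s * s + + 5 * d * d + β x * γ x - + 5 * s * s * (β x + γ x)) * + 25 ∎)
    where
    k l d : ℤ
    k = x 1F + + 4 * x 2F + + 9 * x 3F + + 16 * x 4F
    -- Index differences 2, 3, 4 have squares 4, 9, 16; the coefficients 1, 2, 3 are (4 + 1)/5, (9 +
    -- 1)/5 and (16 - 1)/5.
    l = x 0F * x 2F + x 1F * x 3F + x 2F * x 4F + + 2 * (x 0F * x 3F + x 1F * x 4F) + + 3 * (x 0F * x 4F)
    d = s * k - m * m * + 5 - l
    β-γ : β x - γ x ≡ d * + 5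
    β-γ = begin
      β x - γ x
        ≡⟨ solve 5 (λ x0 x1 x2 x3 x4 →
             let m = x0 :* con (+ 0) :+ (x1 :* con (+ 1) :+ (x2 :* con (+ 2) :+ (x3 :* con (+ 3) :+ (x4 :* con (+ 4) :+ con (+ 0))))) in
             (x0 :* x1 :+ x1 :* x2 :+ x2 :* x3 :+ x3 :* x4 :+ x4 :* x0) :- (x0 :* x2 :+ x1 :* x3 :+ x2 :* x4 :+ x3 :* x0 :+ x4 :* x1)
             := (x0 :+ x1 :+ x2 :+ x3 :+ x4) :* (x1 :+ con (+ 4) :* x2 :+ con (+ 9) :* x3 :+ con (+ 16) :* x4)
                :- m :* m
                :- con (+ 5) :* (x0 :* x2 :+ x1 :* x3 :+ x2 :* x4 :+ con (+ 2) :* (x0 :* x3 :+ x1 :* x4) :+ con (+ 3) :* (x0 :* x4)))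
             ≡.refl (x 0F) (x 1F) (x 2F) (x 3F) (x 4F) ⟩
      σ x * k - moment x * moment x - + 5 * l
        ≡⟨ ≡.cong₂ (λ s m → s * k - m * m - + 5 * l) σ≡ moment≡ ⟩
      s * + 5 * k - m * + 5 * (m * + 5) - + 5 * l
        ≡⟨ solve 4 (λ s k m l → s :* con (+ 5) :* k :- m :* con (+ 5) :* (m :* con (+ 5)) :- con (+ 5) :* l
             := (s :* k :- m :* m :* con (+ 5) :- l) :* con (+ 5)) ≡.refl s k m l ⟩
      d * + 5 ∎

  -- For q ≠ 0 the root is l = -p/q in 𝔽₅; the 25 cases are decided by evaluation.
  form-root : ∀ (p q : Fin 5) → q ≡ 0F ⊎ ∃ λ (l : Fin 5) → (toℕ p ℕ.+ toℕ l ℕ.* toℕ q) % 5 ≡ 0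
  form-root = from-yes (Fin.all? {5} λ p → Fin.all? {5} λ q →
    (q Fin.≟ 0F) ⊎-dec Fin.any? {5} λ l → ((toℕ p ℕ.+ toℕ l ℕ.* toℕ q) % 5 ℕ.≟ 0))

  5∣form : ∀ p q → + 5 ∣ q ⊎ ∃ λ (l : Fin 5) → + 5 ∣ p + + toℕ l * q
  5∣form p q with residue p | residue q
  ... | r , a , ≡.refl | s , b , ≡.refl with form-root r s
  ... | inj₁ ≡.refl = inj₁ (divides b (ℤ.+-identityˡ _))
  ... | inj₂ (l , r+ls≡0) = inj₂ (l , divides (+ ((toℕ r ℕ.+ toℕ l ℕ.* toℕ s) / 5) + a + + toℕ l * b) (begin
    + toℕ r + a * + 5 + + toℕ l * (+ toℕ s + b * + 5)
      ≡⟨ solve 5 (λ r a l s b → r :+ a :* con (+ 5) :+ l :* (s :+ b :* con (+ 5)) := (r :+ l :* s) :+ (a :+ l :* b) :* con (+ 5))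
           ≡.refl (+ toℕ r) a (+ toℕ l) (+ toℕ s) b ⟩
    + toℕ r + + toℕ l * + toℕ s + (a + + toℕ l * b) * + 5
      ≡⟨ ≡.cong (λ e → + toℕ r + e + (a + + toℕ l * b) * + 5) (≡.sym (ℤ.pos-* (toℕ l) (toℕ s))) ⟩
    + n + (a + + toℕ l * b) * + 5
      ≡⟨ ≡.cong (λ e → + e + (a + + toℕ l * b) * + 5) (≡.trans (m≡m%n+[m/n]*n n 5) (≡.cong (ℕ._+ n / 5 ℕ.* 5) r+ls≡0)) ⟩
    + (n / 5 ℕ.* 5) + (a + + toℕ l * b) * + 5
      ≡⟨ ≡.cong (_+ (a + + toℕ l * b) * + 5) (ℤ.pos-* (n / 5) 5) ⟩
    + (n / 5) * + 5 + (a + + toℕ l * b) * + 5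
      ≡⟨ solve 3 (λ x a b → x :* con (+ 5) :+ (a :+ b) :* con (+ 5) := (x :+ a :+ b) :* con (+ 5)) ≡.refl (+ (n / 5)) a (+ toℕ l * b) ⟩
    (+ (n / 5) + a + + toℕ l * b) * + 5 ∎))
    where n = toℕ r ℕ.+ toℕ l ℕ.* toℕ s

  -- The instance with `ι` the identity gives the change of variables for integer weights.
  module ℤ-fibreSum = FromIntegers ℤ.+-*-commutativeRing id
    (Identity.isRingHomomorphism (CommutativeRing.rawRing ℤ.+-*-commutativeRing) ≡.refl)

  σ-fibreSum : ∀ {m n} (φ : Fin m → Fin n → Fin 5) α → σ (fibreSum φ α) ≡ ℤsum λ i → ℤsum λ j → α i j
  σ-fibreSum {m} {n} φ α = begin
    σ b
      ≡⟨ solve 5 (λ x0 x1 x2 x3 x4 → x0 :+ x1 :+ x2 :+ x3 :+ x4 :=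
           x0 :* con (+ 1) :+ (x1 :* con (+ 1) :+ (x2 :* con (+ 1) :+ (x3 :* con (+ 1) :+ (x4 :* con (+ 1) :+ con (+ 0))))))
           ≡.refl (b 0F) (b 1F) (b 2F) (b 3F) (b 4F) ⟩
    ℤsum (λ x → b x * + 1)
      ≡⟨ ℤ-fibreSum.sum-fibreSum φ α (λ _ → + 1) ⟩
    ℤsum (λ i → ℤsum λ j → α i j * + 1)
      ≡⟨ sum-cong-≗ {m} (λ i → sum-cong-≗ {n} λ j → ℤ.*-identityʳ (α i j)) ⟩
    ℤsum (λ i → ℤsum λ j → α i j) ∎
    where b = fibreSum φ α

  ∑∑-linear : ∀ {m n} (α : Fin m → Fin n → ℤ) k (f g : Fin m → Fin n → ℤ) →
    (ℤsum λ i → ℤsum λ j → α i j * (f i j + k * g i j)) ≡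
    (ℤsum λ i → ℤsum λ j → α i j * f i j) + k * (ℤsum λ i → ℤsum λ j → α i j * g i j)
  ∑∑-linear {m} {n} α k f g = begin
    (ℤsum λ i → ℤsum λ j → α i j * (f i j + k * g i j))
      ≡⟨ sum-cong-≗ {m} (λ i → ≡.trans
           (sum-cong-≗ {n} λ j → solve 4 (λ a f k g → a :* (f :+ k :* g) := a :* f :+ k :* (a :* g)) ≡.refl (α i j) (f i j) k (g i j))
           (≡.trans (∑-distrib-+ {n} (λ j → α i j * f i j) (λ j → k * (α i j * g i j)))
             (≡.cong (λ x → ℤsum (λ j → α i j * f i j) + x) (≡.sym (*-distribˡ-sum {n} k (λ j → α i j * g i j)))))) ⟩
    (ℤsum λ i → (ℤsum λ j → α i j * f i j) + k * (ℤsum λ j → α i j * g i j))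
      ≡⟨ ∑-distrib-+ {m} (λ i → ℤsum λ j → α i j * f i j) (λ i → k * (ℤsum λ j → α i j * g i j)) ⟩
    (ℤsum λ i → ℤsum λ j → α i j * f i j) + (ℤsum λ i → k * (ℤsum λ j → α i j * g i j))
      ≡⟨ ≡.cong (λ x → (ℤsum λ i → ℤsum λ j → α i j * f i j) + x) (≡.sym (*-distribˡ-sum {m} k (λ i → ℤsum λ j → α i j * g i j))) ⟩
    (ℤsum λ i → ℤsum λ j → α i j * f i j) + k * (ℤsum λ i → ℤsum λ j → α i j * g i j) ∎

  module _ (α : Fin 5 → Fin 5 → ℤ) where

    private
      P Q : ℤ
      P = ℤsum λ i → ℤsum λ j → α i j * + toℕ i
      Q = ℤsum λ i → ℤsum λ j → α i j * + toℕ j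

      quotient : Fin 5 → Fin 5 → Fin 5 → ℤ
      quotient l i j = + ((toℕ i ℕ.+ toℕ l ℕ.* toℕ j) / 5)

      form-residue : ∀ l i j → + toℕ (form l i j) + + 5 * quotient l i j ≡ + toℕ i + + toℕ l * + toℕ j
      form-residue l i j = begin
        + toℕ (form l i j) + + 5 * quotient l i j
          ≡⟨ ≡.cong₂ (λ x y → + x + y) (Fin.toℕ-fromℕ< (m%n<n n 5)) 
               (≡.trans (ℤ.*-comm (+ 5) (quotient l i j)) (≡.sym (ℤ.pos-* (n / 5) 5))) ⟩
        + (n % 5 ℕ.+ n / 5 ℕ.* 5)
          ≡⟨ ≡.cong +_ (≡.sym (m≡m%n+[m/n]*n n 5)) ⟩
        + toℕ i + + (toℕ l ℕ.* toℕ j)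
          ≡⟨ ≡.cong (λ x → + toℕ i + x) (ℤ.pos-* (toℕ l) (toℕ j)) ⟩
        + toℕ i + + toℕ l * + toℕ j ∎
        where n = toℕ i ℕ.+ toℕ l ℕ.* toℕ j

      -- The residue `form l i j` differs from i + lj by a multiple of 5, so the moment of the
      -- pushforward is P + lQ modulo 5.
      5∣moment : ∀ l → + 5 ∣ P + + toℕ l * Q → + 5 ∣ moment (fibreSum (form l) α)
      5∣moment l 5∣ = ≡.subst (+ 5 ∣_) (≡.sym moment≡) (∣m∣n⇒∣m-n 5∣ (divides Z (ℤ.*-comm (+ 5) Z)))
        where
        Z M : ℤ
        Z = ℤsum λ i → ℤsum λ j → α i j * quotient l i j
        M = ℤsum λ i → ℤsum λ j → α i j * + toℕ (form l i j)
        moment≡ : moment (fibreSum (form l) α) ≡ P + + toℕ l * Q - + 5 * Z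
        moment≡ = begin
          moment (fibreSum (form l) α)
            ≡⟨ ℤ-fibreSum.sum-fibreSum (form l) α (λ x → + toℕ x) ⟩
          M
            ≡⟨ solve 2 (λ m z → m := (m :+ con (+ 5) :* z) :- con (+ 5) :* z) ≡.refl M Z ⟩
          M + + 5 * Z - + 5 * Z
            ≡⟨ ≡.cong (_- + 5 * Z) (≡.sym (∑∑-linear α (+ 5) (λ i j → + toℕ (form l i j)) (quotient l))) ⟩
          (ℤsum λ i → ℤsum λ j → α i j * (+ toℕ (form l i j) + + 5 * quotient l i j)) - + 5 * Z
            ≡⟨ ≡.cong (_- + 5 * Z) (sum-cong-≗ {5} λ i → sum-cong-≗ {5} λ j → ≡.cong (α i j *_) (form-residue l i j)) ⟩
          (ℤsum λ i → ℤsum λ j → α i j * (+ toℕ i + + toℕ l * + toℕ j)) - + 5 * Z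
            ≡⟨ ≡.cong (_- + 5 * Z) (∑∑-linear α (+ toℕ l) (λ i j → + toℕ i) (λ i j → + toℕ j)) ⟩
          P + + toℕ l * Q - + 5 * Z ∎

    module _ (5∣total : + 5 ∣ total α) where

      private
        5∣σ : ∀ (φ : Fin 5 → Fin 5 → Fin 5) → + 5 ∣ σ (fibreSum φ α)
        5∣σ φ = ≡.subst (+ 5 ∣_) (≡.sym (σ-fibreSum φ α)) 5∣total

        5∣orbitNorm : ∀ l → + 5 ∣ orbitNorm α l
        5∣orbitNorm l = 5∣ν (fibreSum (form l) α) (5∣σ (form l))

        5∣orbitNorm∞ : + 5 ∣ orbitNorm∞ α
        5∣orbitNorm∞ = 5∣ν (fibreSum (λ i j → j) α) (5∣σ λ i j → j)

        25∣orbitNorm : ∀ l → + 5 ∣ P + + toℕ l * Q → + 25 ∣ orbitNorm α l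
        25∣orbitNorm l 5∣ = 25∣ν (fibreSum (form l) α) (5∣σ (form l)) (5∣moment l 5∣)

        25∣orbitNorm∞ : + 5 ∣ Q → + 25 ∣ orbitNorm∞ α
        25∣orbitNorm∞ 5∣Q = 25∣ν (fibreSum (λ i j → j) α) (5∣σ λ i j → j)
          (≡.subst (+ 5 ∣_) (≡.sym (ℤ-fibreSum.sum-fibreSum (λ i j → j) α (λ x → + toℕ x))) 5∣Q)

        -- The exponent 8 is one factor 5 from the total, one from each of the six norms, and one
        -- more from the norm divisible by 25.
        orbitProduct : ∀ t n∞ (n : Fin 5 → ℤ) → + 5 ∣ t → + 5 ∣ n∞ → (∀ l → + 5 ∣ n l) →
                       + 25 ∣ n∞ ⊎ (∃ λ l → + 25 ∣ n l) → + (5 ℕ.^ 8) ∣ t * (n∞ * ℤproduct n)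
        orbitProduct t n∞ n 5∣t 5∣n∞ 5∣n n²∣ = *-mono-∣ (+ 5) (+ (5 ℕ.^ 7)) t (n∞ * ℤproduct n) 5∣t (norms n²∣)
          where
          norms : + 25 ∣ n∞ ⊎ (∃ λ l → + 25 ∣ n l) → + (5 ℕ.^ 7) ∣ n∞ * ℤproduct n
          norms (inj₁ 25∣n∞)       = *-mono-∣ (+ 25) (+ (5 ℕ.^ 5)) n∞ (ℤproduct n) 25∣n∞ (^∣product n 5∣n)
          norms (inj₂ (l , 25∣n)) = *-mono-∣ (+ 5) (+ (5 ℕ.^ 6)) n∞ (ℤproduct n) 5∣n∞ (^∣product-extra n 5∣n l 25∣n)

      5^8∣orbitNorms : + (5 ℕ.^ 8) ∣ total α * orbitNorms α
      5^8∣orbitNorms = orbitProduct (total α) (orbitNorm∞ α) (orbitNorm α) 5∣total 5∣orbitNorm∞ 5∣orbitNorm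
        (Sum.map 25∣orbitNorm∞ (λ (l , 5∣) → l , 25∣orbitNorm l 5∣) (5∣form P Q))

  -- Each product in `β` and `γ` has two distinct indices, hence a factor 5rⱼ with j ≠ 0. So 5
  -- divides `ρ`, and the term 5ρ of the norm vanishes modulo 25.
  shift-quintic : ∀ c r → ∃ λ z → σ (shift c r) * νℤ (shift c r) ≡ σ (shift c r) ⁵ + + 25 * z
  shift-quintic c r = t * e , (begin
    t * (t * t * t * t + + 5 * ((β x + γ x) * (β x + γ x) + β x * γ x + - (t * t * (β x + γ x))))
      ≡⟨ ≡.cong₂ (λ b c → t * (t * t * t * t + + 5 * ((b + c) * (b + c) + b * c + - (t * t * (b + c))))) β≡ γ≡ ⟩
    t * (t * t * t * t + + 5 * ((+ 5 * b + + 5 * g) * (+ 5 * b + + 5 * g) + + 5 * b * (+ 5 * g) + - (t * t * (+ 5 * b + + 5 * g))))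
      ≡⟨ solve 3 (λ t b g → let b′ = con (+ 5) :* b; g′ = con (+ 5) :* g in
           t :* (t :* t :* t :* t :+ con (+ 5) :* ((b′ :+ g′) :* (b′ :+ g′) :+ b′ :* g′ :+ :- (t :* t :* (b′ :+ g′))))
           := t :* t :* t :* t :* t :+ con (+ 25) :* (t :* (con (+ 5) :* (b :+ g) :* (b :+ g) :+ con (+ 5) :* b :* g :- t :* t :* (b :+ g))))
           ≡.refl t b g ⟩
    t * t * t * t * t + + 25 * (t * e) ∎)
    where
    x = shift c r
    t = σ x
    b g e : ℤ
    b = x 0F * r 1F + x 1F * r 2F + x 2F * r 3F + x 3F * r 4F + r 4F * x 0F
    g = x 0F * r 2F + x 1F * r 3F + x 2F * r 4F + r 3F * x 0F + x 4F * r 1F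
    e = + 5 * (b + g) * (b + g) + + 5 * b * g - t * t * (b + g)
    β≡ : β x ≡ + 5 * b
    β≡ = solve 9 (λ x0 x1 x2 x3 x4 r1 r2 r3 r4 →
      x0 :* (con (+ 5) :* r1) :+ x1 :* (con (+ 5) :* r2) :+ x2 :* (con (+ 5) :* r3) :+ x3 :* (con (+ 5) :* r4) :+ con (+ 5) :* r4 :* x0
      := con (+ 5) :* (x0 :* r1 :+ x1 :* r2 :+ x2 :* r3 :+ x3 :* r4 :+ r4 :* x0))
      ≡.refl (x 0F) (x 1F) (x 2F) (x 3F) (x 4F) (r 1F) (r 2F) (r 3F) (r 4F)
    γ≡ : γ x ≡ + 5 * g
    γ≡ = solve 9 (λ x0 x1 x2 x3 x4 r1 r2 r3 r4 →
      x0 :* (con (+ 5) :* r2) :+ x1 :* (con (+ 5) :* r3) :+ x2 :* (con (+ 5) :* r4) :+ con (+ 5) :* r3 :* x0 :+ x4 :* (con (+ 5) :* r1)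
      := con (+ 5) :* (x0 :* r2 :+ x1 :* r3 :+ x2 :* r4 :+ r3 :* x0 :+ x4 :* r1))
      ≡.refl (x 0F) (x 1F) (x 2F) (x 3F) (x 4F) (r 1F) (r 2F) (r 3F) (r 4F)

  ⁵-mod-25 : ∀ r p → ∃ λ e → (r + p * + 5) ⁵ ≡ r ⁵ + + 25 * e
  ⁵-mod-25 r p = quinticTerm r p , ≡.trans (≡.cong (λ x → (r + x) ⁵) (ℤ.*-comm p (+ 5))) (quintic r p)

  -- The fifth power modulo 25 depends only on the argument modulo 5; using this twice replaces `s`
  -- by its residue `r`, which leaves finitely many numerical cases.
  twenty-fifth : ∀ {m t s} r p q z → m ≡ t ⁵ + + 25 * z → t ≡ s ⁵ + + 5 * q → s ≡ r + p * + 5 →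
                 ∃ λ e → m ≡ (r ⁵) ⁵ + + 25 * e
  twenty-fifth r p q z ≡.refl ≡.refl ≡.refl = let a , a≡ = ⁵-mod-25 r p; b , b≡ = ⁵-mod-25 (r ⁵) (+ 5 * a + q) in
    b + z , (begin
      ((r + p * + 5) ⁵ + + 5 * q) ⁵ + + 25 * z
        ≡⟨ ≡.cong (λ x → (x + + 5 * q) ⁵ + + 25 * z) a≡ ⟩
      (r ⁵ + + 25 * a + + 5 * q) ⁵ + + 25 * z
        ≡⟨ ≡.cong (λ x → x ⁵ + + 25 * z)
             (solve 3 (λ r a q → r :+ con (+ 25) :* a :+ con (+ 5) :* q := r :+ (con (+ 5) :* a :+ q) :* con (+ 5)) ≡.refl (r ⁵) a q) ⟩
      (r ⁵ + (+ 5 * a + q) * + 5) ⁵ + + 25 * z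
        ≡⟨ ≡.cong (_+ + 25 * z) b≡ ⟩
      (r ⁵) ⁵ + + 25 * b + + 25 * z
        ≡⟨ solve 3 (λ r b z → r :+ con (+ 25) :* b :+ con (+ 25) :* z := r :+ con (+ 25) :* (b :+ z)) ≡.refl ((r ⁵) ⁵) b z ⟩
      (r ⁵) ⁵ + + 25 * (b + z) ∎)

-- The ring ℤ[ζ] as a free module of rank four over ℤ.

record Quadruple (A : Set) : Set where
  constructor ⟨_,_,_,_⟩
  field
    c₀ c₁ c₂ c₃ : A
open Quadruple

-- Arithmetic in the basis 1, ζ, ζ², ζ³, where ζ⁴ = −1 − ζ − ζ² − ζ³.
module Arithmetic {A : Set} (_+_ _*_ : Op₂ A) (-_ : Op₁ A) where
  infixl 6 _⊞_
  infixl 7 _⊠_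
  _⊞_ _⊠_ : Op₂ (Quadruple A)
  ⟨ a , b , c , d ⟩ ⊞ ⟨ a′ , b′ , c′ , d′ ⟩ = ⟨ a + a′ , b + b′ , c + c′ , d + d′ ⟩
  ⟨ a , b , c , d ⟩ ⊠ ⟨ a′ , b′ , c′ , d′ ⟩ = ⟨
    ((a * a′) + ((c * d′) + (d * c′))) + (- e) ,
    ((a * b′) + ((b * a′) + (d * d′))) + (- e) ,
    ((a * c′) + ((b * b′) + (c * a′))) + (- e) ,
    ((a * d′) + ((b * c′) + ((c * b′) + (d * a′)))) + (- e) ⟩
    where e = (b * d′) + ((c * c′) + (d * b′))

  ⊟_ : Op₁ (Quadruple A)
  ⊟ ⟨ a , b , c , d ⟩ = ⟨ - a , - b , - c , - d ⟩

ℤ[ζ] : Set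
ℤ[ζ] = Quadruple ℤ

open Arithmetic ℤ._+_ ℤ._*_ (ℤ.-_)

fromℤ : ℤ → ℤ[ζ]
fromℤ n = ⟨ n , + 0 , + 0 , + 0 ⟩

⟨⟩-cong : ∀ {a a′ b b′ c c′ d d′ : ℤ} → a ≡ a′ → b ≡ b′ → c ≡ c′ → d ≡ d′ → ⟨ a , b , c , d ⟩ ≡ ⟨ a′ , b′ , c′ , d′ ⟩
⟨⟩-cong ≡.refl ≡.refl ≡.refl ≡.refl = ≡.refl

private
  module P where
    open Data.Integer.Solver.+-*-Solver public
    open module A {n} = Arithmetic {Polynomial n} _:+_ _:*_ :-_ public

    -- The multiplication formulas are reused on solver polynomials: a ring law is stated once for
    -- quadruples, and `π` selects the coordinate to be checked.
    law₂ : (f g : Op₂ (Quadruple (Polynomial 8))) (π : Quadruple (Polynomial 8) → Polynomial 8)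
           (a b c d a′ b′ c′ d′ : Polynomial 8) → Polynomial 8 × Polynomial 8
    law₂ f g π a b c d a′ b′ c′ d′ = π (f x y) := π (g x y)
      where
      x = ⟨ a , b , c , d ⟩
      y = ⟨ a′ , b′ , c′ , d′ ⟩

    law₃ : (f g : (x y z : Quadruple (Polynomial 12)) → Quadruple (Polynomial 12))
           (π : Quadruple (Polynomial 12) → Polynomial 12)
           (a b c d a′ b′ c′ d′ a″ b″ c″ d″ : Polynomial 12) → Polynomial 12 × Polynomial 12
    law₃ f g π a b c d a′ b′ c′ d′ a″ b″ c″ d″ = π (f x y z) := π (g x y z)
      where
      x = ⟨ a , b , c , d ⟩
      y = ⟨ a′ , b′ , c′ , d′ ⟩
      z = ⟨ a″ , b″ , c″ , d″ ⟩

⊠-comm : ∀ x y → x ⊠ y ≡ y ⊠ x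
⊠-comm ⟨ a , b , c , d ⟩ ⟨ a′ , b′ , c′ , d′ ⟩ = ⟨⟩-cong
  (P.solve 8 (law c₀) ≡.refl a b c d a′ b′ c′ d′)
  (P.solve 8 (law c₁) ≡.refl a b c d a′ b′ c′ d′)
  (P.solve 8 (law c₂) ≡.refl a b c d a′ b′ c′ d′)
  (P.solve 8 (law c₃) ≡.refl a b c d a′ b′ c′ d′)
  where law = P.law₂ (λ x y → x P.⊠ y) (λ x y → y P.⊠ x)

⊠-assoc : ∀ x y z → (x ⊠ y) ⊠ z ≡ x ⊠ (y ⊠ z)
⊠-assoc ⟨ a , b , c , d ⟩ ⟨ a′ , b′ , c′ , d′ ⟩ ⟨ a″ , b″ , c″ , d″ ⟩ = ⟨⟩-cong
  (P.solve 12 (law c₀) ≡.refl a b c d a′ b′ c′ d′ a″ b″ c″ d″)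
  (P.solve 12 (law c₁) ≡.refl a b c d a′ b′ c′ d′ a″ b″ c″ d″)
  (P.solve 12 (law c₂) ≡.refl a b c d a′ b′ c′ d′ a″ b″ c″ d″)
  (P.solve 12 (law c₃) ≡.refl a b c d a′ b′ c′ d′ a″ b″ c″ d″)
  where law = P.law₃ (λ x y z → (x P.⊠ y) P.⊠ z) (λ x y z → x P.⊠ (y P.⊠ z))

⊠-distribˡ-⊞ : ∀ x y z → x ⊠ (y ⊞ z) ≡ (x ⊠ y) ⊞ (x ⊠ z)
⊠-distribˡ-⊞ ⟨ a , b , c , d ⟩ ⟨ a′ , b′ , c′ , d′ ⟩ ⟨ a″ , b″ , c″ , d″ ⟩ = ⟨⟩-cong
  (P.solve 12 (law c₀) ≡.refl a b c d a′ b′ c′ d′ a″ b″ c″ d″)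
  (P.solve 12 (law c₁) ≡.refl a b c d a′ b′ c′ d′ a″ b″ c″ d″)
  (P.solve 12 (law c₂) ≡.refl a b c d a′ b′ c′ d′ a″ b″ c″ d″)
  (P.solve 12 (law c₃) ≡.refl a b c d a′ b′ c′ d′ a″ b″ c″ d″)
  where law = P.law₃ (λ x y z → x P.⊠ (y P.⊞ z)) (λ x y z → (x P.⊠ y) P.⊞ (x P.⊠ z))

-- Integers act coordinatewise, which reduces both the homomorphism property and cancellation to ℤ.
fromℤ-⊠ : ∀ n x → fromℤ n ⊠ x ≡ ⟨ n ℤ.* c₀ x , n ℤ.* c₁ x , n ℤ.* c₂ x , n ℤ.* c₃ x ⟩
fromℤ-⊠ n ⟨ a , b , c , d ⟩ = ⟨⟩-cong
  (P.solve 5 (law c₀) ≡.refl n a b c d)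
  (P.solve 5 (law c₁) ≡.refl n a b c d)
  (P.solve 5 (law c₂) ≡.refl n a b c d)
  (P.solve 5 (law c₃) ≡.refl n a b c d)
  where
  law : (Quadruple (P.Polynomial 5) → P.Polynomial 5) → (n a b c d : P.Polynomial 5) → P.Polynomial 5 × P.Polynomial 5
  law π n a b c d = π (⟨ n , z , z , z ⟩ P.⊠ ⟨ a , b , c , d ⟩) P.:= π ⟨ n P.:* a , n P.:* b , n P.:* c , n P.:* d ⟩
    where z = P.con (+ 0)

⊠-identityˡ : ∀ x → fromℤ (+ 1) ⊠ x ≡ x
⊠-identityˡ x = ≡.trans (fromℤ-⊠ (+ 1) x)
  (⟨⟩-cong (ℤ.*-identityˡ (c₀ x)) (ℤ.*-identityˡ (c₁ x)) (ℤ.*-identityˡ (c₂ x)) (ℤ.*-identityˡ (c₃ x)))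

ℤ[ζ]-commutativeRing : CommutativeRing 0ℓ 0ℓ
ℤ[ζ]-commutativeRing = record
  { Carrier = ℤ[ζ]
  ; _≈_ = _≡_
  ; _+_ = _⊞_
  ; _*_ = _⊠_
  ; -_  = ⊟_
  ; 0#  = fromℤ (+ 0)
  ; 1#  = fromℤ (+ 1)
  ; isCommutativeRing = record
    { isRing = record
      { +-isAbelianGroup = record
        { isGroup = record
          { isMonoid = record
            { isSemigroup = record
              { isMagma = record { isEquivalence = ≡.isEquivalence ; ∙-cong = ≡.cong₂ _⊞_ }
              ; assoc = λ x y z → ⟨⟩-cong (ℤ.+-assoc (c₀ x) _ _) (ℤ.+-assoc (c₁ x) _ _) (ℤ.+-assoc (c₂ x) _ _) (ℤ.+-assoc (c₃ x) _ _)
              }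
            ; identity = comm∧idˡ⇒id ⊞-comm
                λ x → ⟨⟩-cong (ℤ.+-identityˡ _) (ℤ.+-identityˡ _) (ℤ.+-identityˡ _) (ℤ.+-identityˡ _)
            }
          ; inverse = comm∧invˡ⇒inv ⊞-comm
              λ x → ⟨⟩-cong (ℤ.+-inverseˡ (c₀ x)) (ℤ.+-inverseˡ (c₁ x)) (ℤ.+-inverseˡ (c₂ x)) (ℤ.+-inverseˡ (c₃ x))
          ; ⁻¹-cong = ≡.cong ⊟_
          }
        ; comm = ⊞-comm
        }
      ; *-cong = ≡.cong₂ _⊠_
      ; *-assoc = ⊠-assoc
      ; *-identity = comm∧idˡ⇒id ⊠-comm ⊠-identityˡ
      ; distrib = ⊠-distribˡ-⊞ , comm∧distrˡ⇒distrʳ ⊠-comm ⊠-distribˡ-⊞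
      }
    ; *-comm = ⊠-comm
    }
  }
  where
  ⊞-comm : ∀ x y → x ⊞ y ≡ y ⊞ x
  ⊞-comm x y = ⟨⟩-cong (ℤ.+-comm (c₀ x) _) (ℤ.+-comm (c₁ x) _) (ℤ.+-comm (c₂ x) _) (ℤ.+-comm (c₃ x) _)

fromℤ-isRingHomomorphism : RingMorphisms.IsRingHomomorphism
  (CommutativeRing.rawRing ℤ.+-*-commutativeRing) (CommutativeRing.rawRing ℤ[ζ]-commutativeRing) fromℤ
fromℤ-isRingHomomorphism = record
  { isSemiringHomomorphism = record
    { isNearSemiringHomomorphism = record
      { +-isMonoidHomomorphism = record
        { isMagmaHomomorphism = record
          { isRelHomomorphism = record { cong = ≡.cong fromℤ }
          ; homo = λ _ _ → ≡.refl
          }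
        ; ε-homo = ≡.refl
        }
      ; *-homo = λ m n → ≡.sym (≡.trans (fromℤ-⊠ m (fromℤ n))
          (⟨⟩-cong ≡.refl (ℤ.*-zeroʳ m) (ℤ.*-zeroʳ m) (ℤ.*-zeroʳ m)))
      }
    ; 1#-homo = ≡.refl
    }
  ; -‿homo = λ _ → ≡.refl
  }

fromℤ-⊠-cancelˡ : ∀ n .{{_ : ℤ.NonZero n}} {x y} → fromℤ n ⊠ x ≡ fromℤ n ⊠ y → x ≡ y
fromℤ-⊠-cancelˡ n {x} {y} nx≡ny = ⟨⟩-cong
  (ℤ.*-cancelˡ-≡ n _ _ (≡.cong c₀ scaled)) (ℤ.*-cancelˡ-≡ n _ _ (≡.cong c₁ scaled))
  (ℤ.*-cancelˡ-≡ n _ _ (≡.cong c₂ scaled)) (ℤ.*-cancelˡ-≡ n _ _ (≡.cong c₃ scaled))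
  where
  scaled = ≡.trans (≡.sym (fromℤ-⊠ n x)) (≡.trans nx≡ny (fromℤ-⊠ n y))

fromℤ-injective : ∀ {m n} → fromℤ m ≡ fromℤ n → m ≡ n
fromℤ-injective = ≡.cong Quadruple.c₀

⊠-fromℤ-cancelʳ : ∀ n .{{_ : ℤ.NonZero n}} {x y} → x ⊠ fromℤ n ≡ y ⊠ fromℤ n → x ≡ y
⊠-fromℤ-cancelʳ n {x} {y} eq = fromℤ-⊠-cancelˡ n (≡.trans (⊠-comm (fromℤ n) x) (≡.trans eq (⊠-comm y (fromℤ n))))

-- Explicit group ring elements and the two inclusions.

open FromIntegers.FifthRoot ℤ[ζ]-commutativeRing fromℤ fromℤ-isRingHomomorphism ⟨ + 0 , + 1 , + 0 , + 0 ⟩ ≡.refl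
  using (values; module Descent)
open Descent fromℤ-injective ⊠-fromℤ-cancelʳ using (Θ-norms; Θ-shift; translate∈S)

open import Data.Integer.Base using (-_)

IsShiftedCirculant : ℤ → ℤ → Set
IsShiftedCirculant s m = ∃ λ k → ∃ λ r → ∃ λ q →
  m ≡ Fℤ.σ (shift k r) ℤ.* νℤ (shift k r) × Fℤ.σ (shift k r) ≡ s ⁵ ℤ.+ + 5 ℤ.* q

unit₁ unit₇ b₀ b₁ b₂ : Fin 5 → Fin 5 → ℤ
unit₁ i j = δ i 0F ℤ.* δ j 0F

table : Vec (Vec ℤ 5) 5 → Fin 5 → Fin 5 → ℤ
table A i j = lookup (lookup A i) j

-- 1 + x + (1 + x + x² + x³ + x⁴)(y² + y³ − 1).  If χ(x) ≠ 1, its value at a nontrivial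
-- character χ is the unit 1 + χ(x); if χ(x) = 1, it is 2 + 5(y² + y³ − 1) at a primitive
-- fifth root of unity y, which is minus the fifth power of a fundamental unit of ℚ(√5).
unit₇ = table
  ( (  + 0  ∷ + 0 ∷ + 1 ∷ + 1 ∷ + 0 ∷ [])
  ∷ (  + 0  ∷ + 0 ∷ + 1 ∷ + 1 ∷ + 0 ∷ [])
  ∷ ( -1ℤ   ∷ + 0 ∷ + 1 ∷ + 1 ∷ + 0 ∷ [])
  ∷ ( -1ℤ   ∷ + 0 ∷ + 1 ∷ + 1 ∷ + 0 ∷ [])
  ∷ ( -1ℤ   ∷ + 0 ∷ + 1 ∷ + 1 ∷ + 0 ∷ []) ∷ [])

-- Found by a computer search for elements with five orbit norms 5 and one orbit norm 25.
b₀ = table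
  ( (+ 0 ∷ + 0 ∷ + 0 ∷ + 0 ∷ + 0 ∷ [])
  ∷ (+ 0 ∷ + 0 ∷ + 1 ∷ + 1 ∷ + 0 ∷ [])
  ∷ (+ 0 ∷ + 0 ∷ + 0 ∷ + 0 ∷ + 0 ∷ [])
  ∷ (+ 0 ∷ + 0 ∷ + 0 ∷ + 0 ∷ -1ℤ ∷ [])
  ∷ (-1ℤ ∷ + 0 ∷ + 0 ∷ + 0 ∷ + 0 ∷ []) ∷ [])

b₁ = table
  ( (+ 1 ∷ + 0 ∷ + 1 ∷ + 0 ∷ + 0 ∷ [])
  ∷ (+ 1 ∷ + 0 ∷ + 0 ∷ + 1 ∷ + 0 ∷ [])
  ∷ (+ 0 ∷ + 0 ∷ + 0 ∷ + 0 ∷ + 1 ∷ [])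
  ∷ (+ 0 ∷ + 0 ∷ + 0 ∷ + 0 ∷ + 0 ∷ [])
  ∷ (+ 0 ∷ + 0 ∷ + 0 ∷ + 0 ∷ + 0 ∷ []) ∷ [])

-- The product of b₁ and unit₇ in the group ring, minus the sum of all group elements.
b₂ = table
  ( (+ 0 ∷ + 1 ∷ + 2 ∷ + 0 ∷ -1ℤ ∷ [])
  ∷ (+ 1 ∷ + 1 ∷ + 2 ∷ + 1 ∷ -1ℤ ∷ [])
  ∷ (+ 0 ∷ + 1 ∷ + 1 ∷ + 1 ∷ + 0 ∷ [])
  ∷ (-1ℤ ∷ + 1 ∷ + 1 ∷ + 0 ∷ + 0 ∷ [])
  ∷ (-1ℤ ∷ + 1 ∷ + 1 ∷ + 0 ∷ -1ℤ ∷ []) ∷ [])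

neg : (Fin 5 → Fin 5 → ℤ) → Fin 5 → Fin 5 → ℤ
neg α i j = - α i j

corollary1p2 : S G₅ ≐
    ((λ (m : ℤ) → (m ≡ + 1 [mod 25 ]) ⊎ (m ≡ - (+ 1) [mod 25 ])
    ⊎ (m ≡ + 7 [mod 25 ]) ⊎ (m ≡ - (+ 7) [mod 25 ]))
    ∪ multiplesOfPower 5 8)
corollary1p2 = necessary , sufficient
  where
  open Data.Integer.Solver.+-*-Solver using (solve; _:+_; _:*_; _:-_; con; _:=_)

  FifthPower : ℤ → Set
  FifthPower m = (m ≡ + 1 [mod 25 ]) ⊎ (m ≡ - (+ 1) [mod 25 ]) ⊎ (m ≡ + 7 [mod 25 ]) ⊎ (m ≡ - (+ 7) [mod 25 ])

  congruent : ∀ x n e → x ℤ.+ + 25 ℤ.* n ℤ.+ + 25 ℤ.* e ≡ x [mod 25 ]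
  congruent x n e = divides (n ℤ.+ e)
    (solve 3 (λ x n e → x :+ con (+ 25) :* n :+ con (+ 25) :* e :- x := (n :+ e) :* con (+ 25)) ≡.refl x n e)

  necessary : ∀ {m} → S G₅ m → FifthPower m ⊎ multiplesOfPower 5 8 m
  necessary {m} (a , m≡) = classify m (total (values a))
    (λ 5∣total → ≡.subst (+ (5 ℕ.^ 8) ∣_) (≡.sym (≡.trans m≡ (Θ-norms a))) (5^8∣orbitNorms (values a) 5∣total))
    (≡.subst (IsShiftedCirculant (total (values a))) (≡.sym m≡) (Θ-shift a))
    where
    cases : ∀ (i : Fin 4) e → FifthPower (((+ suc (toℕ i)) ⁵) ⁵ ℤ.+ + 25 ℤ.* e)
    cases 0F e = inj₁ (congruent (+ 1) (+ 0) e)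
    -- The large constants here and below are (2²⁵ - 7)/25, (3²⁵ + 7)/25 and (4²⁵ + 1)/25.
    cases 1F e = inj₂ (inj₂ (inj₁ (congruent (+ 7) (+ 1342177) e)))
    cases 2F e = inj₂ (inj₂ (inj₂ (congruent (- (+ 7)) (+ 33891544378) e)))
    cases 3F e = inj₂ (inj₁ (congruent (- (+ 1)) (+ 45035996273705) e))

    classify : ∀ m s → (+ 5 ∣ s → + (5 ℕ.^ 8) ∣ m) → IsShiftedCirculant s m → FifthPower m ⊎ multiplesOfPower 5 8 m
    classify m s 5∣s⇒5⁸∣m (k , r , q , m≡ , σ≡) = byResidue (residue s)
      where
      byResidue : (∃ λ (i : Fin 5) → ∃ λ p → s ≡ + toℕ i ℤ.+ p ℤ.* + 5) → FifthPower m ⊎ multiplesOfPower 5 8 m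
      byResidue (0F    , p , s≡) = inj₂ (5∣s⇒5⁸∣m (divides p (≡.trans s≡ (ℤ.+-identityˡ (p ℤ.* + 5)))))
      byResidue (suc i , p , s≡) =
        let z , circulant≡ = shift-quintic k r
            e , m≡r²⁵ = twenty-fifth (+ suc (toℕ i)) p q z (≡.trans m≡ circulant≡) σ≡ s≡
        in inj₁ (≡.subst FifthPower (≡.sym m≡r²⁵) (cases i e))

  sufficient : ∀ {m} → FifthPower m ⊎ multiplesOfPower 5 8 m → S G₅ m
  sufficient {m} = λ where
      (inj₁ (inj₁ m≡))               → fifthPower unit₁ (+ 1) ≡.refl ≡.refl m≡
      (inj₁ (inj₂ (inj₁ m≡)))        → fifthPower (neg unit₁) (- (+ 1)) ≡.refl ≡.refl m≡
      (inj₁ (inj₂ (inj₂ (inj₁ m≡)))) → fifthPower unit₇ (+ 7) ≡.refl ≡.refl m≡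
      (inj₁ (inj₂ (inj₂ (inj₂ m≡)))) → fifthPower (neg unit₇) (- (+ 7)) ≡.refl ≡.refl m≡
      (inj₂ (divides n ≡.refl))      → multiple (residue n)
    where
    fifthPower : ∀ α s → total α ≡ s → orbitNorms α ≡ + 1 → m ≡ s [mod 25 ] → S G₅ m
    fifthPower α s total≡ norms≡ (divides k m-s≡) = ≡.subst (S G₅)
      (≡.trans (≡.cong₂ (λ s n → (s ℤ.+ + 25 ℤ.* k) ℤ.* n) total≡ norms≡)
        (≡.trans (solve 2 (λ s k → (s :+ con (+ 25) :* k) :* con (+ 1) := k :* con (+ 25) :+ s) ≡.refl s k)
          (≡.trans (≡.cong (ℤ._+ s) (≡.sym m-s≡)) (solve 2 (λ m s → m :- s :+ s := m) ≡.refl m s))))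
      (translate∈S α k)

    -- Translating an element with total 5s and orbit norms of product 5⁷ yields (s + 5k)5⁸, so one
    -- such element is needed for each residue s modulo 5.
    multiple : ∀ {n} → (∃ λ (r : Fin 5) → ∃ λ p → n ≡ + toℕ r ℤ.+ p ℤ.* + 5) → S G₅ (n ℤ.* + (5 ℕ.^ 8))
    multiple (r , p , ≡.refl) = at r
      where
      scaled : ∀ α s k → total α ≡ + 5 ℤ.* s → orbitNorms α ≡ + (5 ℕ.^ 7) →
                   S G₅ ((s ℤ.+ k ℤ.* + 5) ℤ.* + (5 ℕ.^ 8))
      scaled α s k total≡ norms≡ = ≡.subst (S G₅)
        (≡.trans (≡.cong₂ (λ s n → (s ℤ.+ + 25 ℤ.* k) ℤ.* n) total≡ norms≡)
          (solve 2 (λ s k → (con (+ 5) :* s :+ con (+ 25) :* k) :* con (+ (5 ℕ.^ 7))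
                       := (s :+ k :* con (+ 5)) :* con (+ (5 ℕ.^ 8))) ≡.refl s k))
        (translate∈S α k)

      -- Negation leaves the norms unchanged, as they have even degree, and makes the total
      -- negative; the residue s - 5 is brought back to s by one further translation.
      scaled-neg : ∀ α s k → total α ≡ + 5 ℤ.* (s ℤ.- + 5) → orbitNorms α ≡ + (5 ℕ.^ 7) →
                   S G₅ ((s ℤ.+ k ℤ.* + 5) ℤ.* + (5 ℕ.^ 8))
      scaled-neg α s k total≡ norms≡ = ≡.subst (S G₅)
        (≡.cong (ℤ._* + (5 ℕ.^ 8))
          (solve 2 (λ s k → s :- con (+ 5) :+ (con (+ 1) :+ k) :* con (+ 5) := s :+ k :* con (+ 5)) ≡.refl s k))
        (scaled α (s ℤ.- + 5) (+ 1 ℤ.+ k) total≡ norms≡)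

      -- The totals 0, 5, 10, -10 and -5 represent all multiples of 5 modulo 25. The element `b₂`
      -- has total 5 · 7 - 25 = 10.
      at : ∀ (r : Fin 5) → S G₅ ((+ toℕ r ℤ.+ p ℤ.* + 5) ℤ.* + (5 ℕ.^ 8))
      at 0F = scaled b₀ (+ 0) p ≡.refl ≡.refl
      at 1F = scaled b₁ (+ 1) p ≡.refl ≡.refl
      at 2F = scaled b₂ (+ 2) p ≡.refl ≡.refl
      at 3F = scaled-neg (neg b₂) (+ 3) p ≡.refl ≡.refl
      at 4F = scaled-neg (neg b₁) (+ 4) p ≡.refl ≡.refl
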